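{- Let $E$ be a finite set and let $\omega:2^E\to[0,\infty)$ be Rayleigh. Then $\omega$ is logarithmically submodular: for all $S,T\subseteq E$, $\omega(S)\omega(T)\ge\omega(S\cap T)\,\omega(S\cup T)$.
   Context: For $\omega:2^E\to[0,\infty)$ not identically zero, let $Z(\omega;\mathbf{y})=\sum_{S\subseteq E}\omega(S)\prod_{e\in S}y_e$ in commuting indeterminates $\mathbf{y}=\{y_e:e\in E\}$. Write $Z_e=\partial Z/\partial y_e$, $Z_{ef}=\partial^2Z/\partial y_e\partial y_f$ and $\Delta Z\{e,f\}=Z_eZ_f-Z_{ef}Z$. $\omega$ is Rayleigh if $\Delta Z\{e,f\}(\mathbf{y})\ge0$ for all distinct $e,f\in E$ and all $\mathbf{y}$ with all $y_c>0$. -}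

module Defs where

open import Data.Bool.Base using (if_then_else_)
open import Data.Fin.Base using (Fin)
open import Data.Fin.Properties using () renaming (_≟_ to _≟ᶠ_)
open import Data.Fin.Subset using (Subset; inside; outside; _∩_; _∪_)
open import Data.Fin.Subset.Properties using (_∈?_)
open import Data.List.Base using (List; []; _∷_; _++_; map; foldr; filter; allFin)
open import Data.Nat.Base as ℕ using (ℕ; zero; suc; _⊔_)
import Data.Nat.Properties as ℕ
open import Data.Product.Base using (∃-syntax; _×_; _,_)
open import Data.Rational.Base as ℚ using (ℚ; 0ℚ; 1ℚ; ½; ∣_∣; Positive)
import Data.Rational.Properties as ℚ
open import Data.Rational.Solver using (module +-*-Solver)
import Data.Vec.Base as Vec
open import Relation.Binary.PropositionalEquality
  using (_≡_; _≢_; refl; sym; trans; cong; subst)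
open import Relation.Nullary using (¬_)
open import Relation.Nullary.Decidable using (does)

------------------------------------------------------------------------
-- The real numbers: Cauchy sequences of rationals, with the setoid
-- equality _≈_ in place of a quotient.

IsCauchy : (ℕ → ℚ) → Set
IsCauchy x = ∀ ε → 0ℚ ℚ.< ε →
  ∃[ N ] (∀ m n → N ℕ.≤ m → N ℕ.≤ n → ∣ x m ℚ.- x n ∣ ℚ.< ε)

record ℝ : Set where
  constructor mkℝ
  field
    seq    : ℕ → ℚ
    cauchy : IsCauchy seq

open ℝ public

infix 4 _≈_ _<_ _≤_

_≈_ : ℝ → ℝ → Set
x ≈ y = ∀ ε → 0ℚ ℚ.< ε →
  ∃[ N ] (∀ n → N ℕ.≤ n → ∣ seq x n ℚ.- seq y n ∣ ℚ.< ε)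

_<_ : ℝ → ℝ → Set
x < y = ∃[ ε ] (0ℚ ℚ.< ε ×
  ∃[ N ] (∀ n → N ℕ.≤ n → seq x n ℚ.+ ε ℚ.≤ seq y n))

-- Constructively, _≤_ is the negation of the reversed strict order; it is
-- not the disjunction of _<_ and _≈_.
_≤_ : ℝ → ℝ → Set
x ≤ y = ¬ (y < x)

private
  halves : ∀ ε → ε ℚ.* ½ ℚ.+ ε ℚ.* ½ ≡ ε
  halves ε = trans (sym (ℚ.*-distribˡ-+ ε ½ ½)) (ℚ.*-identityʳ ε)

  half-pos : ∀ {ε} → 0ℚ ℚ.< ε → 0ℚ ℚ.< ε ℚ.* ½
  half-pos {ε} 0<ε = ℚ.positive⁻¹ (ε ℚ.* ½)
    {{ℚ.pos*pos⇒pos ε {{ℚ.positive 0<ε}} ½}}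

  const-cauchy : ∀ q → IsCauchy (λ _ → q)
  const-cauchy q ε 0<ε = 0 , λ _ _ _ _ →
    subst (λ t → ∣ t ∣ ℚ.< ε) (sym (ℚ.+-inverseʳ q)) 0<ε

  +-cauchy : ∀ {x y} → IsCauchy x → IsCauchy y → IsCauchy (λ n → x n ℚ.+ y n)
  +-cauchy {x} {y} cx cy ε 0<ε
    with M , f ← cx (ε ℚ.* ½) (half-pos 0<ε)
       | N , g ← cy (ε ℚ.* ½) (half-pos 0<ε)
    = M ⊔ N , λ m n p q → begin-strict
        ∣ (x m ℚ.+ y m) ℚ.- (x n ℚ.+ y n) ∣
          ≡⟨ cong ∣_∣ (rearrange (x m) (y m) (x n) (y n)) ⟩
        ∣ (x m ℚ.- x n) ℚ.+ (y m ℚ.- y n) ∣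
          ≤⟨ ℚ.∣p+q∣≤∣p∣+∣q∣ (x m ℚ.- x n) (y m ℚ.- y n) ⟩
        ∣ x m ℚ.- x n ∣ ℚ.+ ∣ y m ℚ.- y n ∣
          <⟨ ℚ.+-mono-< (f m n (ℕ.m⊔n≤o⇒m≤o M N p) (ℕ.m⊔n≤o⇒m≤o M N q))
                        (g m n (ℕ.m⊔n≤o⇒n≤o M N p) (ℕ.m⊔n≤o⇒n≤o M N q)) ⟩
        ε ℚ.* ½ ℚ.+ ε ℚ.* ½
          ≡⟨ halves ε ⟩
        ε ∎
    where
    open ℚ.≤-Reasoning
    rearrange : ∀ a b c d → (a ℚ.+ b) ℚ.- (c ℚ.+ d) ≡ (a ℚ.- c) ℚ.+ (b ℚ.- d)
    rearrange = solve 4 (λ a b c d →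
      ((a :+ b) :- (c :+ d)) := ((a :- c) :+ (b :- d))) refl
      where open +-*-Solver

  neg-cauchy : ∀ {x} → IsCauchy x → IsCauchy (λ n → ℚ.- x n)
  neg-cauchy {x} cx ε 0<ε with N , f ← cx ε 0<ε = N , λ m n p q →
    subst (ℚ._< ε)
      (trans (sym (ℚ.∣-p∣≡∣p∣ (x m ℚ.- x n)))
             (cong ∣_∣ (ℚ.neg-distrib-+ (x m) (ℚ.- x n))))
      (f m n p q)

  bounded : ∀ {x} → IsCauchy x →
    ∃[ B ] (0ℚ ℚ.< B × ∃[ N ] (∀ n → N ℕ.≤ n → ∣ x n ∣ ℚ.≤ B))
  bounded {x} cx with N , f ← cx 1ℚ (ℚ.positive⁻¹ 1ℚ) =
    1ℚ ℚ.+ ∣ x N ∣ ,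
    ℚ.+-mono-<-≤ (ℚ.positive⁻¹ 1ℚ) (ℚ.0≤∣p∣ (x N)) ,
    N , λ n p → begin
      ∣ x n ∣
        ≡⟨ cong ∣_∣ (sub-add (x n) (x N)) ⟩
      ∣ (x n ℚ.- x N) ℚ.+ x N ∣
        ≤⟨ ℚ.∣p+q∣≤∣p∣+∣q∣ (x n ℚ.- x N) (x N) ⟩
      ∣ x n ℚ.- x N ∣ ℚ.+ ∣ x N ∣
        ≤⟨ ℚ.+-monoˡ-≤ ∣ x N ∣ (ℚ.<⇒≤ (f n N p ℕ.≤-refl)) ⟩
      1ℚ ℚ.+ ∣ x N ∣ ∎
    where
    open ℚ.≤-Reasoning
    sub-add : ∀ a b → a ≡ (a ℚ.- b) ℚ.+ b
    sub-add = solve 2 (λ a b → a := ((a :- b) :+ b)) refl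
      where open +-*-Solver

  *-bound : ∀ {p q B δ} → 0ℚ ℚ.< B → ∣ p ∣ ℚ.≤ B → ∣ q ∣ ℚ.< δ →
    ∣ p ℚ.* q ∣ ℚ.< B ℚ.* δ
  *-bound {p} {q} {B} {δ} 0<B p≤B q<δ = begin-strict
    ∣ p ℚ.* q ∣
      ≡⟨ ℚ.∣p*q∣≡∣p∣*∣q∣ p q ⟩
    ∣ p ∣ ℚ.* ∣ q ∣
      ≤⟨ ℚ.*-monoʳ-≤-nonNeg ∣ q ∣ {{ℚ.nonNegative (ℚ.0≤∣p∣ q)}} p≤B ⟩
    B ℚ.* ∣ q ∣
      <⟨ ℚ.*-monoʳ-<-pos B {{ℚ.positive 0<B}} q<δ ⟩
    B ℚ.* δ ∎
    where open ℚ.≤-Reasoning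

  divide : ∀ {C ε} → 0ℚ ℚ.< C → 0ℚ ℚ.< ε → ∃[ δ ] (0ℚ ℚ.< δ × C ℚ.* δ ≡ ε)
  divide {C} {ε} 0<C 0<ε = C⁻¹ ℚ.* ε , ℚ.positive⁻¹ (C⁻¹ ℚ.* ε) , eq
    where
    instance
      C-pos : Positive C
      C-pos = ℚ.positive 0<C
      C-nonZero : ℚ.NonZero C
      C-nonZero = ℚ.pos⇒nonZero C
    C⁻¹ : ℚ
    C⁻¹ = ℚ.1/ C
    instance
      C⁻¹ε-pos : Positive (C⁻¹ ℚ.* ε)
      C⁻¹ε-pos = ℚ.pos*pos⇒pos C⁻¹ {{ℚ.1/pos⇒pos C}} ε {{ℚ.positive 0<ε}}
    eq : C ℚ.* (C⁻¹ ℚ.* ε) ≡ ε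
    eq = trans (sym (ℚ.*-assoc C C⁻¹ ε))
      (trans (cong (ℚ._* ε) (ℚ.*-inverseʳ C)) (ℚ.*-identityˡ ε))

  *-split : ∀ p q r s →
    p ℚ.* q ℚ.- r ℚ.* s ≡ p ℚ.* (q ℚ.- s) ℚ.+ s ℚ.* (p ℚ.- r)
  *-split = solve 4 (λ p q r s →
    ((p :* q) :- (r :* s)) := ((p :* (q :- s)) :+ (s :* (p :- r)))) refl
    where open +-*-Solver

  *-close : ∀ {A B δ} p q r s → 0ℚ ℚ.< A → 0ℚ ℚ.< B →
    ∣ p ∣ ℚ.≤ A → ∣ s ∣ ℚ.≤ B → ∣ q ℚ.- s ∣ ℚ.< δ → ∣ p ℚ.- r ∣ ℚ.< δ →
    ∣ p ℚ.* q ℚ.- r ℚ.* s ∣ ℚ.< (A ℚ.+ B) ℚ.* δ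
  *-close {A} {B} {δ} p q r s 0<A 0<B p≤A s≤B q-s p-r = begin-strict
    ∣ p ℚ.* q ℚ.- r ℚ.* s ∣
      ≡⟨ cong ∣_∣ (*-split p q r s) ⟩
    ∣ p ℚ.* (q ℚ.- s) ℚ.+ s ℚ.* (p ℚ.- r) ∣
      ≤⟨ ℚ.∣p+q∣≤∣p∣+∣q∣ (p ℚ.* (q ℚ.- s)) (s ℚ.* (p ℚ.- r)) ⟩
    ∣ p ℚ.* (q ℚ.- s) ∣ ℚ.+ ∣ s ℚ.* (p ℚ.- r) ∣
      <⟨ ℚ.+-mono-< (*-bound {p} {q ℚ.- s} 0<A p≤A q-s)
                    (*-bound {s} {p ℚ.- r} 0<B s≤B p-r) ⟩
    A ℚ.* δ ℚ.+ B ℚ.* δ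
      ≡⟨ sym (ℚ.*-distribʳ-+ δ A B) ⟩
    (A ℚ.+ B) ℚ.* δ ∎
    where open ℚ.≤-Reasoning

  -- A with-abstraction here would normalise the products of rationals in the
  -- goal, at prohibitive cost.
  *-cauchy : ∀ {x y} → IsCauchy x → IsCauchy y → IsCauchy (λ n → x n ℚ.* y n)
  *-cauchy {x} {y} cx cy ε 0<ε =
    let A , 0<A , K , a = bounded cx
        B , 0<B , L , b = bounded cy
        δ , 0<δ , eq = divide {A ℚ.+ B} (ℚ.+-mono-< 0<A 0<B) 0<ε
        M , f = cx δ 0<δ
        N , g = cy δ 0<δ
    in (K ⊔ L) ⊔ (M ⊔ N) , λ m n p q →
      let KL≤m = ℕ.m⊔n≤o⇒m≤o (K ⊔ L) (M ⊔ N) p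
          KL≤n = ℕ.m⊔n≤o⇒m≤o (K ⊔ L) (M ⊔ N) q
          MN≤m = ℕ.m⊔n≤o⇒n≤o (K ⊔ L) (M ⊔ N) p
          MN≤n = ℕ.m⊔n≤o⇒n≤o (K ⊔ L) (M ⊔ N) q
      in subst (∣ x m ℚ.* y m ℚ.- x n ℚ.* y n ∣ ℚ.<_) eq
        (*-close (x m) (y m) (x n) (y n) 0<A 0<B
          (a m (ℕ.m⊔n≤o⇒m≤o K L KL≤m)) (b n (ℕ.m⊔n≤o⇒n≤o K L KL≤n))
          (g m n (ℕ.m⊔n≤o⇒n≤o M N MN≤m) (ℕ.m⊔n≤o⇒n≤o M N MN≤n))
          (f m n (ℕ.m⊔n≤o⇒m≤o M N MN≤m) (ℕ.m⊔n≤o⇒m≤o M N MN≤n)))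

infixl 6 _+_
infixl 7 _*_
infix  8 -_

0ℝ 1ℝ : ℝ
0ℝ = mkℝ (λ _ → 0ℚ) (const-cauchy 0ℚ)
1ℝ = mkℝ (λ _ → 1ℚ) (const-cauchy 1ℚ)

_+_ _*_ : ℝ → ℝ → ℝ
x + y = mkℝ (λ n → seq x n ℚ.+ seq y n) (+-cauchy {seq x} {seq y} (cauchy x) (cauchy y))
x * y = mkℝ (λ n → seq x n ℚ.* seq y n) (*-cauchy {seq x} {seq y} (cauchy x) (cauchy y))

-_ : ℝ → ℝ
- x = mkℝ (λ n → ℚ.- seq x n) (neg-cauchy {seq x} (cauchy x))

------------------------------------------------------------------------
-- Polynomials over ℝ in indeterminates indexed by Fin n, as ring
-- expressions: a polynomial may be written in several ways, but only its
-- values at points of ℝⁿ are ever compared.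

infixl 6 _:+_ _:-_
infixl 7 _:*_
infix  8 :-_

data Poly (n : ℕ) : Set where
  con  : ℝ → Poly n
  var  : Fin n → Poly n
  _:+_ : Poly n → Poly n → Poly n
  _:*_ : Poly n → Poly n → Poly n
  :-_  : Poly n → Poly n

_:-_ : ∀ {n} → Poly n → Poly n → Poly n
p :- q = p :+ (:- q)

⟦_⟧ : ∀ {n} → Poly n → (Fin n → ℝ) → ℝ
⟦ con c ⟧  y = c
⟦ var e ⟧  y = y e
⟦ p :+ q ⟧ y = ⟦ p ⟧ y + ⟦ q ⟧ y
⟦ p :* q ⟧ y = ⟦ p ⟧ y * ⟦ q ⟧ y
⟦ :- p ⟧   y = - ⟦ p ⟧ y

∂ : ∀ {n} → Fin n → Poly n → Poly n
∂ e (con c)  = con 0ℝ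
∂ e (var f)  = con (if does (e ≟ᶠ f) then 1ℝ else 0ℝ)
∂ e (p :+ q) = ∂ e p :+ ∂ e q
∂ e (p :* q) = (∂ e p :* q) :+ (p :* ∂ e q)
∂ e (:- p)   = :- ∂ e p

∑ ∏ : ∀ {n} → List (Poly n) → Poly n
∑ = foldr _:+_ (con 0ℝ)
∏ = foldr _:*_ (con 1ℝ)

------------------------------------------------------------------------
-- Rayleigh set functions; the ground set E is Fin n.

-- Lists every subset exactly once.
subsets : ∀ n → List (Subset n)
subsets zero    = Vec.[] ∷ []
subsets (suc n) = map (outside Vec.∷_) (subsets n) ++ map (inside Vec.∷_) (subsets n)

-- ∏_{e ∈ S} y_e
monomial : ∀ {n} → Subset n → Poly n
monomial {n} S = ∏ (map var (filter (_∈? S) (allFin n)))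

Z : ∀ {n} → (Subset n → ℝ) → Poly n
Z {n} ω = ∑ (map (λ S → con (ω S) :* monomial S) (subsets n))

ΔZ : ∀ {n} → (Subset n → ℝ) → Fin n → Fin n → Poly n
ΔZ ω e f = (∂ e (Z ω) :* ∂ f (Z ω)) :- (∂ e (∂ f (Z ω)) :* Z ω)

Rayleigh : ∀ {n} → (Subset n → ℝ) → Set
Rayleigh {n} ω = ∀ (e f : Fin n) → e ≢ f →
  ∀ (y : Fin n → ℝ) → (∀ c → 0ℝ < y c) → 0ℝ ≤ ⟦ ΔZ ω e f ⟧ y

LogSubmodular : ∀ {n} → (Subset n → ℝ) → Set
LogSubmodular {n} ω = ∀ (S T : Subset n) → ω (S ∩ T) * ω (S ∪ T) ≤ ω S * ω T

{-# OPTIONS --safe #-}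

-- Z is affine in every variable, so Z (y + s e) Z (y + t f) - Z y Z (y + s e + t f)
-- = s t ΔZ {e , f} y, and the Rayleigh property says that S ↦ Z (y_S), where
-- y_S is K on S and ε off S, is locally log-submodular. For ε > 0 it is also
-- positive, as ω is not identically zero, so local submodularity implies the
-- global one. With K = 1 / ε the product ε^|S| Z (y_S) is the sum over A of
-- ω A ε^|A Δ S|, which lies between ω S and ω S + ε ∑ ω; let ε tend to 0.

module Submission where

open import Defs
open import Data.Nat.Base using (ℕ)
open import Data.Fin.Subset using (Subset)
open import Relation.Nullary using (¬_)

open import Data.Bool.Base using (true; false; if_then_else_; not)
open import Data.Empty using (⊥-elim)
open import Data.Fin.Base using (Fin; zero; suc)
open import Data.Fin.Properties using (0≢1+n; suc-injective) renaming (_≟_ to _≟ᶠ_)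
open import Data.Fin.Subset using (inside; outside; _∩_; _∪_)
open import Data.Fin.Subset.Properties using (_∈?_; ∩-comm; ∪-comm)
open import Data.List.Base using ([]; _∷_; _++_; map; filter; allFin; tabulate)
open import Data.List.Properties using (map-++; map-tabulate)
open import Data.List.Relation.Unary.All using (All; []; _∷_)
open import Data.List.Relation.Unary.AllPairs using ([]; _∷_)
open import Data.List.Relation.Unary.Unique.Propositional using (Unique)
open import Data.List.Relation.Unary.Unique.Propositional.Properties using (filter⁺; allFin⁺)
open import Data.Nat.Base as ℕ using (zero; suc; _⊔_)
import Data.Nat.Properties as ℕ
open import Data.Product.Base using (∃-syntax; _×_; _,_)
open import Data.Rational.Base as ℚ using (ℚ; 0ℚ; 1ℚ; ½; ∣_∣)
import Data.Rational.Properties as ℚ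
open import Data.Rational.Solver using (module +-*-Solver)
open import Data.Sum.Base using (_⊎_; inj₁; inj₂)
open import Data.Unit.Base using (⊤; tt)
open import Data.Vec.Base using ([]; _∷_; lookup; _[_]≔_)
open import Data.Vec.Properties using (lookup∘update; lookup∘update′)
open import Function.Base using (id; _∘_)
open import Relation.Binary.PropositionalEquality
  using (_≡_; _≢_; refl; sym; trans; cong; cong₂; subst; subst₂)
open import Relation.Nullary using (Dec; yes; no; does)
open +-*-Solver using (solve) renaming
  (_:+_ to _⊕_; _:*_ to _⊗_; _:-_ to _⊖_; :-_ to ⊝_; _:=_ to _⊜_; con to κ)

-- Order on the reals

-- The passage from local to global submodularity divides by values of the set function, while `ω`
-- may vanish on many sets, and the Rayleigh inequality is given only at points with all coordinates
-- positive. Neither tool applies to `ω` directly, hence the detour through strictly positive points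
-- and a limit at the end. The factor ε^|S| keeps the family bounded while K = 1 / ε grows: it
-- brings the coefficient of ω S down to 1 and leaves a positive power of ε on all others. It does
-- no harm to the inequality, since |S ∩ T| + |S ∪ T| = |S| + |T| makes its contribution to both
-- sides the same. The reals are sequences with termwise operations. Algebra is therefore done on
-- rationals index by index, and only inequalities carry a slack.

≤-shift : ∀ {p q r s} → p ℚ.≤ q → q ℚ.- p ≡ s ℚ.- r → r ℚ.≤ s
≤-shift {p} {q} {r} {s} p≤q eq = subst₂ ℚ._≤_
  (solve 2 (λ p r → p ⊕ (r ⊖ p) ⊜ r) refl p r)
  (trans (solve 3 (λ p q r → q ⊕ (r ⊖ p) ⊜ (q ⊖ p) ⊕ r) refl p q r)
    (trans (cong (ℚ._+ r) eq) (solve 2 (λ r s → (s ⊖ r) ⊕ r ⊜ s) refl r s)))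
  (ℚ.+-monoˡ-≤ (r ℚ.- p) p≤q)

half-pos : ∀ {δ} → 0ℚ ℚ.< δ → 0ℚ ℚ.< ½ ℚ.* δ
half-pos {δ} 0<δ = ℚ.positive⁻¹ (½ ℚ.* δ) {{ℚ.pos*pos⇒pos ½ δ {{ℚ.positive 0<δ}}}}

halves : ∀ δ → ½ ℚ.* δ ℚ.+ ½ ℚ.* δ ≡ δ
halves δ = trans (sym (ℚ.*-distribʳ-+ δ ½ ½)) (ℚ.*-identityˡ δ)

pos*pos : ∀ {p q} → 0ℚ ℚ.< p → 0ℚ ℚ.< q → 0ℚ ℚ.< p ℚ.* q
pos*pos {p} {q} 0<p 0<q =
  ℚ.positive⁻¹ (p ℚ.* q) {{ℚ.pos*pos⇒pos p {{ℚ.positive 0<p}} q {{ℚ.positive 0<q}}}}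

nonNeg*nonNeg : ∀ {p q} → 0ℚ ℚ.≤ p → 0ℚ ℚ.≤ q → 0ℚ ℚ.≤ p ℚ.* q
nonNeg*nonNeg {p} {q} 0≤p 0≤q = ℚ.nonNegative⁻¹ (p ℚ.* q)
  {{ℚ.nonNeg*nonNeg⇒nonNeg p {{ℚ.nonNegative 0≤p}} q {{ℚ.nonNegative 0≤q}}}}

divide : ∀ {C ε} → 0ℚ ℚ.< C → 0ℚ ℚ.< ε → ∃[ δ ] (0ℚ ℚ.< δ × C ℚ.* δ ≡ ε)
divide {C} {ε} 0<C 0<ε = C⁻¹ ℚ.* ε
  , pos*pos (ℚ.positive⁻¹ C⁻¹ {{ℚ.1/pos⇒pos C}}) 0<ε
  , trans (sym (ℚ.*-assoc C C⁻¹ ε))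
      (trans (cong (ℚ._* ε) (ℚ.*-inverseʳ C)) (ℚ.*-identityˡ ε))
  where
  instance
    C-pos : ℚ.Positive C
    C-pos = ℚ.positive 0<C
    C-nonZero : ℚ.NonZero C
    C-nonZero = ℚ.pos⇒nonZero C
  C⁻¹ : ℚ
  C⁻¹ = ℚ.1/ C

≤∣∣ : ∀ p → p ℚ.≤ ∣ p ∣
≤∣∣ p with ℚ.≤-total 0ℚ p
... | inj₁ 0≤p = ℚ.≤-reflexive (sym (ℚ.0≤p⇒∣p∣≡p 0≤p))
... | inj₂ p≤0 = ℚ.≤-trans p≤0 (ℚ.0≤∣p∣ p)

∣∣<⇒≤+ : ∀ {p q δ} → ∣ p ℚ.- q ∣ ℚ.< δ → p ℚ.≤ q ℚ.+ δ
-- As in most rational estimates below, `≤-shift` leaves a single known inequality and a ring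
-- identity between two differences, which the solver settles.
∣∣<⇒≤+ {p} {q} {δ} h = ≤-shift (ℚ.≤-trans (≤∣∣ (p ℚ.- q)) (ℚ.<⇒≤ h))
  (solve 3 (λ p q δ → δ ⊖ (p ⊖ q) ⊜ (q ⊕ δ) ⊖ p) refl p q δ)

∣∣≤ : ∀ {p δ} → p ℚ.≤ δ → ℚ.- δ ℚ.≤ p → ∣ p ∣ ℚ.≤ δ
∣∣≤ {p} {δ} p≤δ -δ≤p with ℚ.∣p∣≡p∨∣p∣≡-p p
... | inj₁ eq = subst (ℚ._≤ δ) (sym eq) p≤δ
... | inj₂ eq = subst (ℚ._≤ δ) (sym eq)
  (≤-shift -δ≤p (solve 2 (λ p δ → p ⊖ (⊝ δ) ⊜ δ ⊖ (⊝ p)) refl p δ))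

infix 4 _≐_ _≼_

-- Much finer than `_≈_`, yet enough for every ring identity used here: the operations on `ℝ` act
-- termwise, so no moduli of convergence are needed.
record _≐_ (x y : ℝ) : Set where
  constructor pointwise
  field at : ∀ k → seq x k ≡ seq y k
open _≐_

-- Equivalent to _≤_, but stated positively and, being a record, it lets the
-- endpoints be inferred.
record _≼_ (x y : ℝ) : Set where
  constructor approximately
  field within : ∀ {δ} → 0ℚ ℚ.< δ →
          ∃[ N ] (∀ n → N ℕ.≤ n → seq x n ℚ.≤ seq y n ℚ.+ δ)
open _≼_

record Pos (x : ℝ) : Set where
  constructor above
  field
    {bound}   : ℚ
    bound-pos : 0ℚ ℚ.< bound
    {from}    : ℕ
    bounded   : ∀ n → from ℕ.≤ n → bound ℚ.≤ seq x n
open Pos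

ι : ℚ → ℝ
ι q = mkℝ (λ _ → q) (λ ε 0<ε → 0 , λ _ _ _ _ →
  subst (λ t → ∣ t ∣ ℚ.< ε) (sym (ℚ.+-inverseʳ q)) 0<ε)

≐-sym : ∀ {x y} → x ≐ y → y ≐ x
≐-sym x≐y .at k = sym (x≐y .at k)

≐⇒≼ : ∀ {x y} → x ≐ y → x ≼ y
≐⇒≼ {x} {y} x≐y .within {δ} 0<δ = 0 , λ n _ → ≤-shift (ℚ.<⇒≤ 0<δ)
  (subst (λ t → δ ℚ.- 0ℚ ≡ (seq y n ℚ.+ δ) ℚ.- t) (sym (x≐y .at n))
    (solve 2 (λ y δ → δ ⊖ κ 0ℚ ⊜ (y ⊕ δ) ⊖ y) refl (seq y n) δ))

≼-refl : ∀ {x} → x ≼ x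
≼-refl = ≐⇒≼ (pointwise λ _ → refl)

≼-trans : ∀ {x y z} → x ≼ y → y ≼ z → x ≼ z
≼-trans {x} {y} {z} x≼y y≼z .within {δ} 0<δ =
  let M , f = x≼y .within (half-pos 0<δ)
      N , g = y≼z .within (half-pos 0<δ)
  in M ⊔ N , λ n p → ≤-shift
       (ℚ.+-mono-≤ (f n (ℕ.m⊔n≤o⇒m≤o M N p)) (g n (ℕ.m⊔n≤o⇒n≤o M N p)))
       (trans
         (solve 4 (λ x y z h → ((y ⊕ h) ⊕ (z ⊕ h)) ⊖ (x ⊕ y) ⊜ (z ⊕ (h ⊕ h)) ⊖ x) refl
           (seq x n) (seq y n) (seq z n) (½ ℚ.* δ))
         (cong (λ t → (seq z n ℚ.+ t) ℚ.- seq x n) (halves δ)))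

≼-resp : ∀ {x x′ y y′} → x ≐ x′ → y ≐ y′ → x ≼ y → x′ ≼ y′
≼-resp x≐x′ y≐y′ x≼y = ≼-trans (≐⇒≼ (≐-sym x≐x′)) (≼-trans x≼y (≐⇒≼ y≐y′))

≼⇒≤ : ∀ {x y} → x ≼ y → x ≤ y
≼⇒≤ {x} {y} x≼y (ε , 0<ε , N , f) =
  let M , g = x≼y .within (half-pos 0<ε)
      n = M ⊔ N
  in ℚ.<-irrefl refl (ℚ.<-≤-trans (half-pos 0<ε) (≤-shift
       (ℚ.+-mono-≤ (f n (ℕ.m≤n⊔m M N)) (g n (ℕ.m≤m⊔n M N)))
       (trans
         (cong (λ t → (seq x n ℚ.+ (seq y n ℚ.+ ½ ℚ.* ε)) ℚ.- ((seq y n ℚ.+ t) ℚ.+ seq x n))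
           (sym (halves ε)))
         (solve 3 (λ x y h → (x ⊕ (y ⊕ h)) ⊖ ((y ⊕ (h ⊕ h)) ⊕ x) ⊜ κ 0ℚ ⊖ h) refl
           (seq x n) (seq y n) (½ ℚ.* ε)))))

-- At an index where x - y varies by less than δ / 2, the order of x - y and
-- δ / 2 is decidable, and the wrong order would separate x from y.
≤⇒≼ : ∀ {x y} → x ≤ y → x ≼ y
≤⇒≼ {x} {y} x≤y .within {δ} 0<δ = decide (d N ℚ.≤? η)
  where
  d : ℕ → ℚ
  d = seq (x + (- y))
  η : ℚ
  η = ½ ℚ.* δ
  N : ℕ
  N = let N , _ = cauchy (x + (- y)) η (half-pos 0<δ) in N
  near : ∀ m n → N ℕ.≤ m → N ℕ.≤ n → ∣ d m ℚ.- d n ∣ ℚ.< η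
  near = let _ , f = cauchy (x + (- y)) η (half-pos 0<δ) in f
  decide : _ → ∃[ N ] (∀ n → N ℕ.≤ n → seq x n ℚ.≤ seq y n ℚ.+ δ)
  decide (yes dN≤η) = N , λ n p → ≤-shift
    (ℚ.+-mono-≤ (∣∣<⇒≤+ {d n} {d N} (near n N p ℕ.≤-refl)) dN≤η)
    (trans
      (solve 4 (λ x y dN h → ((dN ⊕ h) ⊕ h) ⊖ ((x ⊖ y) ⊕ dN) ⊜ (y ⊕ (h ⊕ h)) ⊖ x) refl
        (seq x n) (seq y n) (d N) η)
      (cong (λ t → (seq y n ℚ.+ t) ℚ.- seq x n) (halves δ)))
  decide (no dN≰η) = ⊥-elim (x≤y (d N ℚ.- η , 0<dN-η , N , λ n p → ≤-shift
    (∣∣<⇒≤+ {d N} {d n} (near N n ℕ.≤-refl p))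
    (solve 4 (λ x y dN h → ((x ⊖ y) ⊕ h) ⊖ dN ⊜ x ⊖ (y ⊕ (dN ⊖ h))) refl
      (seq x n) (seq y n) (d N) η)))
    where
    0<dN-η : 0ℚ ℚ.< d N ℚ.- η
    0<dN-η = subst (ℚ._< d N ℚ.- η) (ℚ.+-inverseʳ η) (ℚ.+-monoˡ-< (ℚ.- η) (ℚ.≰⇒> dN≰η))

≼-antisym : ∀ {x y} → x ≼ y → y ≼ x → x ≈ y
≼-antisym {x} {y} x≼y y≼x ε 0<ε =
  let M , f = x≼y .within (half-pos 0<ε)
      N , g = y≼x .within (half-pos 0<ε)
  in M ⊔ N , λ n p → ℚ.≤-<-trans
       (∣∣≤ {δ = ½ ℚ.* ε}
         (≤-shift (f n (ℕ.m⊔n≤o⇒m≤o M N p))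
           (solve 3 (λ x y h → (y ⊕ h) ⊖ x ⊜ h ⊖ (x ⊖ y)) refl (seq x n) (seq y n) (½ ℚ.* ε)))
         (≤-shift (g n (ℕ.m⊔n≤o⇒n≤o M N p))
           (solve 3 (λ x y h → (x ⊕ h) ⊖ y ⊜ (x ⊖ y) ⊖ (⊝ h)) refl
             (seq x n) (seq y n) (½ ℚ.* ε))))
       (subst₂ ℚ._<_ (ℚ.+-identityʳ (½ ℚ.* ε)) (halves ε)
         (ℚ.+-monoʳ-< (½ ℚ.* ε) (half-pos 0<ε)))

Pos⇒< : ∀ {x} → Pos x → 0ℝ < x
Pos⇒< {x} x>0 = bound x>0 , bound-pos x>0 , from x>0 , λ n p →
  subst (ℚ._≤ seq x n) (sym (ℚ.+-identityˡ (bound x>0))) (bounded x>0 n p)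

<⇒Pos : ∀ {x} → 0ℝ < x → Pos x
<⇒Pos {x} (r , 0<r , N , f) = above 0<r λ n p →
  subst (ℚ._≤ seq x n) (ℚ.+-identityˡ r) (f n p)

Pos⇒≽0 : ∀ {x} → Pos x → 0ℝ ≼ x
Pos⇒≽0 {x} x>0 .within {δ} 0<δ = from x>0 , λ n p →
  subst (ℚ._≤ seq x n ℚ.+ δ) (ℚ.+-identityˡ 0ℚ)
    (ℚ.+-mono-≤ (ℚ.≤-trans (ℚ.<⇒≤ (bound-pos x>0)) (bounded x>0 n p)) (ℚ.<⇒≤ 0<δ))

ι-Pos : ∀ {q} → 0ℚ ℚ.< q → Pos (ι q)
ι-Pos 0<q = above 0<q {from = 0} λ _ _ → ℚ.≤-refl

ι-mono : ∀ {p q} → p ℚ.≤ q → ι p ≼ ι q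
ι-mono {p} {q} p≤q .within {δ} 0<δ = 0 , λ _ _ →
  subst (ℚ._≤ q ℚ.+ δ) (ℚ.+-identityʳ p) (ℚ.+-mono-≤ p≤q (ℚ.<⇒≤ 0<δ))

+-mono-≼ : ∀ {x y u v} → x ≼ y → u ≼ v → x + u ≼ y + v
+-mono-≼ {x} {y} {u} {v} x≼y u≼v .within {δ} 0<δ =
  let M , f = x≼y .within (half-pos 0<δ)
      N , g = u≼v .within (half-pos 0<δ)
  in M ⊔ N , λ n p → ≤-shift
       (ℚ.+-mono-≤ (f n (ℕ.m⊔n≤o⇒m≤o M N p)) (g n (ℕ.m⊔n≤o⇒n≤o M N p)))
       (trans
         (solve 5 (λ x y u v h → ((y ⊕ h) ⊕ (v ⊕ h)) ⊖ (x ⊕ u) ⊜ ((y ⊕ v) ⊕ (h ⊕ h)) ⊖ (x ⊕ u))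
           refl (seq x n) (seq y n) (seq u n) (seq v n) (½ ℚ.* δ))
         (cong (λ t → (seq (y + v) n ℚ.+ t) ℚ.- seq (x + u) n) (halves δ)))

upper-bound : ∀ x → ∃[ B ] (0ℚ ℚ.< B × ∃[ N ] (∀ n → N ℕ.≤ n → seq x n ℚ.≤ B))
upper-bound x =
  let N , f = cauchy x 1ℚ (ℚ.positive⁻¹ 1ℚ)
  in ∣ seq x N ∣ ℚ.+ 1ℚ
     , ℚ.+-mono-≤-< (ℚ.0≤∣p∣ (seq x N)) (ℚ.positive⁻¹ 1ℚ)
     , N , λ n p → ℚ.≤-trans (∣∣<⇒≤+ (f n N p ℕ.≤-refl)) (ℚ.+-monoˡ-≤ 1ℚ (≤∣∣ (seq x N)))

-- From -η ≤ p ≤ A and -θ ≤ q ≤ B follows p q ≥ -(B η + (A + η) θ); the slacks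
-- η and θ are chosen in this order to make both terms δ / 2.
*-≽0 : ∀ {x y} → 0ℝ ≼ x → 0ℝ ≼ y → 0ℝ ≼ x * y
*-≽0 {x} {y} x≽0 y≽0 .within {δ} 0<δ =
  let A , 0<A , K , a = upper-bound x
      B , 0<B , L , b = upper-bound y
      η , 0<η , eη = divide 0<B (half-pos 0<δ)
      θ , 0<θ , eθ = divide (ℚ.+-mono-< 0<A 0<η) (half-pos 0<δ)
      M , f = x≽0 .within 0<η
      N , g = y≽0 .within 0<θ
  in (K ⊔ L) ⊔ (M ⊔ N) , λ n r →
    let KL = ℕ.m⊔n≤o⇒m≤o (K ⊔ L) (M ⊔ N) r
        MN = ℕ.m⊔n≤o⇒n≤o (K ⊔ L) (M ⊔ N) r
    in estimate (seq x n) (seq y n) (ℚ.<⇒≤ 0<η) (ℚ.<⇒≤ 0<θ)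
         (a n (ℕ.m⊔n≤o⇒m≤o K L KL)) (b n (ℕ.m⊔n≤o⇒n≤o K L KL))
         (f n (ℕ.m⊔n≤o⇒m≤o M N MN)) (g n (ℕ.m⊔n≤o⇒n≤o M N MN)) eη eθ
  where
  estimate : ∀ {A B η θ} p q → 0ℚ ℚ.≤ η → 0ℚ ℚ.≤ θ → p ℚ.≤ A → q ℚ.≤ B →
    0ℚ ℚ.≤ p ℚ.+ η → 0ℚ ℚ.≤ q ℚ.+ θ →
    B ℚ.* η ≡ ½ ℚ.* δ → (A ℚ.+ η) ℚ.* θ ≡ ½ ℚ.* δ → 0ℚ ℚ.≤ p ℚ.* q ℚ.+ δ
  estimate {A} {B} {η} {θ} p q 0≤η 0≤θ p≤A q≤B 0≤p+η 0≤q+θ eη eθ = ≤-shift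
    (ℚ.+-mono-≤ (nonNeg*nonNeg 0≤p+η 0≤q+θ)
      (ℚ.+-mono-≤
        (ℚ.*-monoʳ-≤-nonNeg η {{ℚ.nonNegative 0≤η}} q≤B)
        (ℚ.*-monoʳ-≤-nonNeg θ {{ℚ.nonNegative 0≤θ}} (ℚ.+-monoˡ-≤ η p≤A))))
    (trans
      (cong₂ (λ s t → (p ℚ.+ η) ℚ.* (q ℚ.+ θ) ℚ.+ (s ℚ.+ t)
                ℚ.- (0ℚ ℚ.+ (q ℚ.* η ℚ.+ (p ℚ.+ η) ℚ.* θ))) eη eθ)
      (trans
        (solve 5 (λ p q η θ h →
          (((p ⊕ η) ⊗ (q ⊕ θ)) ⊕ (h ⊕ h)) ⊖ (κ 0ℚ ⊕ ((q ⊗ η) ⊕ ((p ⊕ η) ⊗ θ)))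
            ⊜ ((p ⊗ q) ⊕ (h ⊕ h)) ⊖ κ 0ℚ) refl p q η θ (½ ℚ.* δ))
        (cong (λ t → p ℚ.* q ℚ.+ t ℚ.- 0ℚ) (halves δ))))

x≼y⇒0≼y-x : ∀ {x y} → x ≼ y → 0ℝ ≼ y + (- x)
x≼y⇒0≼y-x {x} {y} x≼y = ≼-resp
  (pointwise λ k → ℚ.+-inverseʳ (seq x k)) (pointwise λ _ → refl)
  (+-mono-≼ x≼y (≼-refl { - x}))

0≼y-x⇒x≼y : ∀ {x y} → 0ℝ ≼ y + (- x) → x ≼ y
0≼y-x⇒x≼y {x} {y} h = ≼-resp
  (pointwise λ k → ℚ.+-identityˡ (seq x k))
  (pointwise λ k → solve 2 (λ x y → (y ⊖ x) ⊕ x ⊜ y) refl (seq x k) (seq y k))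
  (+-mono-≼ h (≼-refl {x}))

*-monoʳ-≼ : ∀ {z} → 0ℝ ≼ z → ∀ {x y} → x ≼ y → x * z ≼ y * z
*-monoʳ-≼ {z} z≽0 {x} {y} x≼y = 0≼y-x⇒x≼y (≼-resp
  (pointwise λ _ → refl)
  (pointwise λ k → solve 3 (λ x y z → (y ⊖ x) ⊗ z ⊜ (y ⊗ z) ⊖ (x ⊗ z)) refl
    (seq x k) (seq y k) (seq z k))
  (*-≽0 (x≼y⇒0≼y-x x≼y) z≽0))

*-comm : ∀ x y → x * y ≐ y * x
*-comm x y .at k = ℚ.*-comm (seq x k) (seq y k)

*-mono-≼ : ∀ {x y u v} → 0ℝ ≼ u → 0ℝ ≼ y → x ≼ y → u ≼ v → x * u ≼ y * v
*-mono-≼ {x} {y} {u} {v} u≽0 y≽0 x≼y u≼v = ≼-trans (*-monoʳ-≼ u≽0 x≼y)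
  (≼-resp (*-comm u y) (*-comm v y) (*-monoʳ-≼ y≽0 u≼v))

+-Pos : ∀ {x y} → Pos x → 0ℝ ≼ y → Pos (x + y)
+-Pos {x} {y} (above {r} 0<r {M} f) y≽0 =
  let N , g = y≽0 .within (half-pos 0<r)
  in above (half-pos 0<r) {M ⊔ N} λ n p → ≤-shift
       (ℚ.+-mono-≤ (f n (ℕ.m⊔n≤o⇒m≤o M N p)) (g n (ℕ.m⊔n≤o⇒n≤o M N p)))
       (trans
         (cong (λ t → (seq x n ℚ.+ (seq y n ℚ.+ ½ ℚ.* r)) ℚ.- (t ℚ.+ 0ℚ)) (sym (halves r)))
         (solve 3 (λ x y h → (x ⊕ (y ⊕ h)) ⊖ ((h ⊕ h) ⊕ κ 0ℚ) ⊜ (x ⊕ y) ⊖ h) refl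
           (seq x n) (seq y n) (½ ℚ.* r)))

*-Pos : ∀ {x y} → Pos x → Pos y → Pos (x * y)
*-Pos {x} {y} (above {r} 0<r {M} f) (above {s} 0<s {N} g) =
  above (pos*pos 0<r 0<s) {M ⊔ N} λ n p →
    let fn = f n (ℕ.m⊔n≤o⇒m≤o M N p)
        gn = g n (ℕ.m⊔n≤o⇒n≤o M N p)
    in ℚ.≤-trans
         (ℚ.*-monoʳ-≤-nonNeg s {{ℚ.nonNegative (ℚ.<⇒≤ 0<s)}} fn)
         (ℚ.*-monoˡ-≤-nonNeg (seq x n) {{ℚ.nonNegative (ℚ.≤-trans (ℚ.<⇒≤ 0<r) fn)}} gn)

Pos-resp : ∀ {x y} → x ≐ y → Pos x → Pos y
Pos-resp x≐y (above {r} 0<r f) = above 0<r λ n p → subst (r ℚ.≤_) (x≐y .at n) (f n p)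

-- Avoids inverting `z`. Through `≤⇒≼` it is enough to refute a gap δ by which `x` exceeds `y`;
-- multiplied by `z`, whose terms are eventually at least r, it becomes a gap δ r between the
-- products.
*-cancelʳ-≼ : ∀ {x y z} → Pos z → x * z ≼ y * z → x ≼ y
*-cancelʳ-≼ {x} {y} {z} (above {r} 0<r {N} g) xz≼yz =
  ≤⇒≼ λ { (δ , 0<δ , M , f) → ≼⇒≤ xz≼yz
    (δ ℚ.* r , pos*pos 0<δ 0<r , M ⊔ N , λ n p →
      let fn = f n (ℕ.m⊔n≤o⇒m≤o M N p)
          gn = g n (ℕ.m⊔n≤o⇒n≤o M N p)
      in ℚ.≤-trans
           (ℚ.+-monoʳ-≤ (seq y n ℚ.* seq z n)
             (ℚ.*-monoˡ-≤-nonNeg δ {{ℚ.nonNegative (ℚ.<⇒≤ 0<δ)}} gn))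
           (subst (ℚ._≤ seq x n ℚ.* seq z n) (ℚ.*-distribʳ-+ (seq z n) (seq y n) δ)
             (ℚ.*-monoʳ-≤-nonNeg (seq z n)
               {{ℚ.nonNegative (ℚ.≤-trans (ℚ.<⇒≤ 0<r) gn)}} fn))) }

≼-limit : ∀ {x y} C → (∀ {ε} → 0ℚ ℚ.< ε → ε ℚ.≤ 1ℚ → x ≼ y + ι ε * C) → x ≼ y
≼-limit {x} {y} C h .within {δ} 0<δ =
  let B , 0<B , K , b = upper-bound C
      0<h = half-pos 0<δ
      0<B+h = ℚ.+-mono-< 0<B 0<h
      -- With h = δ / 2 the choice ε = h / (B + h) gives both ε ≤ 1 and B ε ≤ h; the other h is the
      -- slack of the hypothesis at this ε.
      ε , 0<ε , eq = divide 0<B+h 0<h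
      ε≤1 = ℚ.*-cancelˡ-≤-pos (B ℚ.+ ½ ℚ.* δ) {{ℚ.positive 0<B+h}}
        (subst₂ ℚ._≤_ (trans (ℚ.+-identityˡ (½ ℚ.* δ)) (sym eq))
          (sym (ℚ.*-identityʳ (B ℚ.+ ½ ℚ.* δ)))
          (ℚ.+-monoˡ-≤ (½ ℚ.* δ) (ℚ.<⇒≤ 0<B)))
      N , f = h 0<ε ε≤1 .within 0<h
      εB≤h = subst (B ℚ.* ε ℚ.≤_) eq (ℚ.*-monoʳ-≤-nonNeg ε {{ℚ.nonNegative (ℚ.<⇒≤ 0<ε)}}
        (subst (ℚ._≤ B ℚ.+ ½ ℚ.* δ) (ℚ.+-identityʳ B) (ℚ.+-monoʳ-≤ B (ℚ.<⇒≤ 0<h))))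
  in K ⊔ N , λ n p → ≤-shift
       (ℚ.+-mono-≤ (f n (ℕ.m⊔n≤o⇒n≤o K N p))
         (ℚ.≤-trans (ℚ.*-monoʳ-≤-nonNeg ε {{ℚ.nonNegative (ℚ.<⇒≤ 0<ε)}}
           (b n (ℕ.m⊔n≤o⇒m≤o K N p))) εB≤h))
       (trans
         (solve 5 (λ x y c ε h → (((y ⊕ (ε ⊗ c)) ⊕ h) ⊕ h) ⊖ (x ⊕ (c ⊗ ε)) ⊜ (y ⊕ (h ⊕ h)) ⊖ x)
           refl (seq x n) (seq y n) (seq C n) ε (½ ℚ.* δ))
         (cong (λ t → (seq y n ℚ.+ t) ℚ.- seq x n) (halves δ)))

-- Affinity of Z in each variable

Free : ∀ {n} → Fin n → Poly n → Set
Free e (con c)  = ⊤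
Free e (var f)  = e ≢ f
Free e (p :+ q) = Free e p × Free e q
Free e (p :* q) = Free e p × Free e q
Free e (:- p)   = Free e p

-- A condition on the expression rather than on its values, so that it is checked by recursion and
-- survives differentiation. One free factor in every product rules out higher powers of the
-- variable.
Affine : ∀ {n} → Fin n → Poly n → Set
Affine e (con c)  = ⊤
Affine e (var f)  = ⊤
Affine e (p :+ q) = Affine e p × Affine e q
Affine e (p :* q) = (Affine e p × Free e q) ⊎ (Free e p × Affine e q)
Affine e (:- p)   = Affine e p

∂-Free : ∀ {n} (e f : Fin n) p → Free e p → Free e (∂ f p)
∂-Free e f (con c)  _         = tt
∂-Free e f (var g)  _         = tt
∂-Free e f (p :+ q) (fp , fq) = ∂-Free e f p fp , ∂-Free e f q fq
∂-Free e f (p :* q) (fp , fq) = (∂-Free e f p fp , fq) , (fp , ∂-Free e f q fq)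
∂-Free e f (:- p)   fp        = ∂-Free e f p fp

-- `second-difference` expands in the variable `e` not only `Z ω` but also `∂ f (Z ω)`.
∂-Affine : ∀ {n} (e f : Fin n) p → Affine e p → Affine e (∂ f p)
∂-Affine e f (con c)  _                = tt
∂-Affine e f (var g)  _                = tt
∂-Affine e f (p :+ q) (ap , aq)        = ∂-Affine e f p ap , ∂-Affine e f q aq
∂-Affine e f (p :* q) (inj₁ (ap , fq)) =
  inj₁ (∂-Affine e f p ap , fq) , inj₁ (ap , ∂-Free e f q fq)
∂-Affine e f (p :* q) (inj₂ (fp , aq)) =
  inj₂ (∂-Free e f p fp , aq) , inj₂ (fp , ∂-Affine e f q aq)
∂-Affine e f (:- p)   ap               = ∂-Affine e f p ap

AgreeOff : ∀ {n} → Fin n → (y y′ : Fin n → ℝ) → Set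
AgreeOff e y y′ = ∀ c → c ≢ e → y′ c ≡ y c

Free-const : ∀ {n} {e : Fin n} {y y′} → AgreeOff e y y′ →
  ∀ p → Free e p → ⟦ p ⟧ y′ ≐ ⟦ p ⟧ y
Free-const h (con c)  _         .at k = refl
Free-const h (var f)  e≢f       .at k = cong (λ z → seq z k) (h f (e≢f ∘ sym))
Free-const h (p :+ q) (fp , fq) .at k =
  cong₂ ℚ._+_ (Free-const h p fp .at k) (Free-const h q fq .at k)
Free-const h (p :* q) (fp , fq) .at k =
  cong₂ ℚ._*_ (Free-const h p fp .at k) (Free-const h q fq .at k)
Free-const h (:- p)   fp        .at k = cong ℚ.-_ (Free-const h p fp .at k)

-- `∂` never simplifies, so the product rule leaves a summand with the derivative of the free
-- factor; that summand vanishes only in value.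
Free-∂≐0 : ∀ {n} {e : Fin n} {y} p → Free e p → ⟦ ∂ e p ⟧ y ≐ 0ℝ
Free-∂≐0 (con c) _ .at k = refl
Free-∂≐0 {e = e} (var f) e≢f .at k with e ≟ᶠ f
... | yes e≡f = ⊥-elim (e≢f e≡f)
... | no  _   = refl
Free-∂≐0 (p :+ q) (fp , fq) .at k =
  cong₂ ℚ._+_ (Free-∂≐0 p fp .at k) (Free-∂≐0 q fq .at k)
Free-∂≐0 {y = y} (p :* q) (fp , fq) .at k = trans
  (cong₂ (λ s t → s ℚ.* seq (⟦ q ⟧ y) k ℚ.+ seq (⟦ p ⟧ y) k ℚ.* t)
    (Free-∂≐0 p fp .at k) (Free-∂≐0 q fq .at k))
  (solve 2 (λ p q → (κ 0ℚ ⊗ q) ⊕ (p ⊗ κ 0ℚ) ⊜ κ 0ℚ) refl (seq (⟦ p ⟧ y) k) (seq (⟦ q ⟧ y) k))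
Free-∂≐0 (:- p) fp .at k = cong ℚ.-_ (Free-∂≐0 p fp .at k)

-- The decision is an argument so that matching on it reduces the `if` which `∂ e (var f)` contains.
var-expand : ∀ {n} {e f : Fin n} {y y′} → AgreeOff e y y′ → (e≟f : Dec (e ≡ f)) →
  y′ f ≐ y f + (y′ e + (- y e)) * (if does e≟f then 1ℝ else 0ℝ)
var-expand {e = e} {y = y} {y′} h (yes refl) .at k =
  solve 2 (λ a b → b ⊜ a ⊕ ((b ⊖ a) ⊗ κ 1ℚ)) refl (seq (y e) k) (seq (y′ e) k)
var-expand {e = e} {f} {y} {y′} h (no e≢f) .at k = trans
  (cong (λ z → seq z k) (h f (e≢f ∘ sym)))
  (solve 2 (λ c t → c ⊜ c ⊕ (t ⊗ κ 0ℚ)) refl (seq (y f) k) (seq (y′ e) k ℚ.- seq (y e) k))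

-- The first-order Taylor formula is exact here: in a product one factor does not change, so no
-- quadratic term arises.
Affine-expand : ∀ {n} {e : Fin n} {y y′} → AgreeOff e y y′ → ∀ p → Affine e p →
  ⟦ p ⟧ y′ ≐ ⟦ p ⟧ y + (y′ e + (- y e)) * ⟦ ∂ e p ⟧ y
Affine-expand {e = e} {y} {y′} h (con c) _ .at k =
  solve 2 (λ c t → c ⊜ c ⊕ (t ⊗ κ 0ℚ)) refl (seq c k) (seq (y′ e) k ℚ.- seq (y e) k)
Affine-expand {e = e} {y} {y′} h (var f) _ .at k =
  var-expand {e = e} {f} {y} {y′} h (e ≟ᶠ f) .at k
Affine-expand {e = e} {y} {y′} h (p :+ q) (ap , aq) .at k = trans
  (cong₂ ℚ._+_ (Affine-expand h p ap .at k) (Affine-expand h q aq .at k))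
  (solve 5 (λ p p′ q q′ t → (p ⊕ (t ⊗ p′)) ⊕ (q ⊕ (t ⊗ q′)) ⊜ (p ⊕ q) ⊕ (t ⊗ (p′ ⊕ q′))) refl
    (seq (⟦ p ⟧ y) k) (seq (⟦ ∂ e p ⟧ y) k) (seq (⟦ q ⟧ y) k) (seq (⟦ ∂ e q ⟧ y) k)
    (seq (y′ e) k ℚ.- seq (y e) k))
Affine-expand {e = e} {y} {y′} h (p :* q) (inj₁ (ap , fq)) .at k = trans
  (cong₂ ℚ._*_ (Affine-expand h p ap .at k) (Free-const h q fq .at k))
  (trans
    (solve 4 (λ p p′ q t →
      (p ⊕ (t ⊗ p′)) ⊗ q ⊜ (p ⊗ q) ⊕ (t ⊗ ((p′ ⊗ q) ⊕ (p ⊗ κ 0ℚ)))) refl P P′ Q t)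
    (cong (λ q′ → P ℚ.* Q ℚ.+ t ℚ.* (P′ ℚ.* Q ℚ.+ P ℚ.* q′)) (sym (Free-∂≐0 {y = y} q fq .at k))))
  where
  P P′ Q t : ℚ
  P  = seq (⟦ p ⟧ y) k
  P′ = seq (⟦ ∂ e p ⟧ y) k
  Q  = seq (⟦ q ⟧ y) k
  t  = seq (y′ e) k ℚ.- seq (y e) k
Affine-expand {e = e} {y} {y′} h (p :* q) (inj₂ (fp , aq)) .at k = trans
  (cong₂ ℚ._*_ (Free-const h p fp .at k) (Affine-expand h q aq .at k))
  (trans
    (solve 4 (λ p q q′ t →
      p ⊗ (q ⊕ (t ⊗ q′)) ⊜ (p ⊗ q) ⊕ (t ⊗ ((κ 0ℚ ⊗ q) ⊕ (p ⊗ q′)))) refl P Q Q′ t)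
    (cong (λ p′ → P ℚ.* Q ℚ.+ t ℚ.* (p′ ℚ.* Q ℚ.+ P ℚ.* Q′)) (sym (Free-∂≐0 {y = y} p fp .at k))))
  where
  P Q Q′ t : ℚ
  P  = seq (⟦ p ⟧ y) k
  Q  = seq (⟦ q ⟧ y) k
  Q′ = seq (⟦ ∂ e q ⟧ y) k
  t  = seq (y′ e) k ℚ.- seq (y e) k
Affine-expand {e = e} {y} {y′} h (:- p) ap .at k = trans
  (cong ℚ.-_ (Affine-expand h p ap .at k))
  (solve 3 (λ p p′ t → ⊝ (p ⊕ (t ⊗ p′)) ⊜ (⊝ p) ⊕ (t ⊗ (⊝ p′))) refl
    (seq (⟦ p ⟧ y) k) (seq (⟦ ∂ e p ⟧ y) k) (seq (y′ e) k ℚ.- seq (y e) k))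

∏-Free : ∀ {n} {e : Fin n} {es} → All (e ≢_) es → Free e (∏ (map var es))
∏-Free []         = tt
∏-Free (e≢f ∷ es) = e≢f , ∏-Free es

-- Distinct entries make the monomial square-free: once `e` is met at the head, the tail is free of
-- it.
∏-Affine : ∀ {n} (e : Fin n) {es} → Unique es → Affine e (∏ (map var es))
∏-Affine e [] = tt
∏-Affine e (_∷_ {f} f≢es es!) with e ≟ᶠ f
... | yes refl = inj₁ (tt , ∏-Free f≢es)
... | no  e≢f  = inj₂ (e≢f , ∏-Affine e es!)

Z-Affine : ∀ {n} (e : Fin n) (ω : Subset n → ℝ) → Affine e (Z ω)
Z-Affine {n} e ω = go (subsets n)
  where
  go : ∀ Ss → Affine e (∑ (map (λ S → con (ω S) :* monomial S) Ss))
  go []       = tt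
  go (S ∷ Ss) = inj₂ (tt , ∏-Affine e (filter⁺ (_∈? S) (allFin⁺ n))) , go Ss

-- With values z, zᵉ, zᶠ, zᵉᶠ of `Z ω` and its derivatives at `y`, the right side is (z + t zᵉ)(z +
-- t zᶠ) and the first product on the left is z (z + t zᵉ + t zᶠ + t² zᵉᶠ). They differ by t² (zᵉ zᶠ
-- - zᵉᶠ z).
second-difference : ∀ {n} (ω : Subset n → ℝ) {e f : Fin n} {y yᵉ yᶠ yᵉᶠ} t →
  AgreeOff e y yᵉ → AgreeOff f y yᶠ → AgreeOff f yᵉ yᵉᶠ →
  yᵉ e + (- y e) ≐ t → yᶠ f + (- y f) ≐ t → yᵉᶠ f + (- yᵉ f) ≐ t →
  ⟦ Z ω ⟧ y * ⟦ Z ω ⟧ yᵉᶠ + (t * t) * ⟦ ΔZ ω e f ⟧ y ≐ ⟦ Z ω ⟧ yᵉ * ⟦ Z ω ⟧ yᶠ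
second-difference ω {e} {f} {y} {yᵉ} {yᶠ} {yᵉᶠ} t hᵉ hᶠ hᵉᶠ tᵉ tᶠ tᵉᶠ .at k = trans
  (cong (λ s → z ℚ.* s ℚ.+ τ ℚ.* τ ℚ.* (zᵉ ℚ.* zᶠ ℚ.- zᵉᶠ ℚ.* z)) at-yᵉᶠ)
  (trans
    (solve 5 (λ z zᵉ zᶠ zᵉᶠ t →
      (z ⊗ ((z ⊕ (t ⊗ zᵉ)) ⊕ (t ⊗ (zᶠ ⊕ (t ⊗ zᵉᶠ)))))
        ⊕ ((t ⊗ t) ⊗ ((zᵉ ⊗ zᶠ) ⊖ (zᵉᶠ ⊗ z)))
        ⊜ (z ⊕ (t ⊗ zᵉ)) ⊗ (z ⊕ (t ⊗ zᶠ))) refl z zᵉ zᶠ zᵉᶠ τ)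
    (sym (cong₂ ℚ._*_ (at-yᵉ (Z ω) (Z-Affine e ω)) at-yᶠ)))
  where
  z zᵉ zᶠ zᵉᶠ τ : ℚ
  z   = seq (⟦ Z ω ⟧ y) k
  zᵉ  = seq (⟦ ∂ e (Z ω) ⟧ y) k
  zᶠ  = seq (⟦ ∂ f (Z ω) ⟧ y) k
  zᵉᶠ = seq (⟦ ∂ e (∂ f (Z ω)) ⟧ y) k
  τ   = seq t k
  at-yᵉ : ∀ p → Affine e p →
    seq (⟦ p ⟧ yᵉ) k ≡ seq (⟦ p ⟧ y) k ℚ.+ τ ℚ.* seq (⟦ ∂ e p ⟧ y) k
  at-yᵉ p ap = trans (Affine-expand hᵉ p ap .at k)
    (cong (λ s → seq (⟦ p ⟧ y) k ℚ.+ s ℚ.* seq (⟦ ∂ e p ⟧ y) k) (tᵉ .at k))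
  at-yᶠ : seq (⟦ Z ω ⟧ yᶠ) k ≡ z ℚ.+ τ ℚ.* zᶠ
  at-yᶠ = trans (Affine-expand hᶠ (Z ω) (Z-Affine f ω) .at k)
    (cong (λ s → z ℚ.+ s ℚ.* zᶠ) (tᶠ .at k))
  -- Expand in `f` around `yᵉ`, then expand both the value and the derivative found there in `e`
  -- around `y`.
  at-yᵉᶠ : seq (⟦ Z ω ⟧ yᵉᶠ) k ≡ (z ℚ.+ τ ℚ.* zᵉ) ℚ.+ τ ℚ.* (zᶠ ℚ.+ τ ℚ.* zᵉᶠ)
  at-yᵉᶠ = trans (Affine-expand hᵉᶠ (Z ω) (Z-Affine f ω) .at k)
    (cong₂ ℚ._+_ (at-yᵉ (Z ω) (Z-Affine e ω))
      (cong₂ ℚ._*_ (tᵉᶠ .at k) (at-yᵉ (∂ f (Z ω)) (∂-Affine e f (Z ω) (Z-Affine e ω)))))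

-- From local to global submodularity

infix 4 _∙_≼_∙_

-- This is a * b ≼ c * d, unfolded to the level of sequences because Agda
-- compares products of reals together with their large Cauchy proofs. For the
-- same reason implicit reals are given explicitly in what follows.
record _∙_≼_∙_ (a b c d : ℝ) : Set where
  constructor products
  field compare : ∀ {δ} → 0ℚ ℚ.< δ →
          ∃[ N ] (∀ n → N ℕ.≤ n → seq a n ℚ.* seq b n ℚ.≤ seq c n ℚ.* seq d n ℚ.+ δ)
open _∙_≼_∙_

∙⇒* : ∀ {a b c d} → a ∙ b ≼ c ∙ d → a * b ≼ c * d
∙⇒* (products h) = approximately h

*⇒∙ : ∀ {a b c d} → a * b ≼ c * d → a ∙ b ≼ c ∙ d
*⇒∙ h = products (h .within)

∙-comm : ∀ a b → a ∙ b ≼ b ∙ a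
∙-comm a b = *⇒∙ {a} {b} {b} {a} (≐⇒≼ {a * b} {b * a} (*-comm a b))

∙-refl : ∀ a b → a ∙ b ≼ a ∙ b
∙-refl a b = *⇒∙ {a} {b} {a} {b} (≼-refl {a * b})

∙-swap : ∀ {a b c d} → a ∙ b ≼ c ∙ d → a ∙ b ≼ d ∙ c
∙-swap {a} {b} {c} {d} h =
  *⇒∙ {a} {b} {d} {c} (≼-trans {a * b} {c * d} {d * c}
    (∙⇒* {a} {b} {c} {d} h) (≐⇒≼ {c * d} {d * c} (*-comm c d)))

-- Transitivity of p / q ≤ n / m ≤ s / r in cross-multiplied form: multiply the two inequalities and
-- cancel m n. Only m and n are cancelled, so q and r may vanish.
∙-chain : ∀ {m n p q r s} → Pos m → Pos n → 0ℝ ≼ q → 0ℝ ≼ r →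
  p ∙ m ≼ q ∙ n → n ∙ r ≼ m ∙ s → p ∙ r ≼ q ∙ s
∙-chain {m} {n} {p} {q} {r} {s} m>0 n>0 q≽0 r≽0 pm≼qn nr≼ms = *⇒∙ {p} {r} {q} {s}
  (*-cancelʳ-≼ {p * r} {q * s} {m * n} (*-Pos {m} {n} m>0 n>0) (≼-resp
    {(p * m) * (n * r)} {(p * r) * (m * n)} {(q * n) * (m * s)} {(q * s) * (m * n)}
    (pointwise λ k → solve 4 (λ m n p r → (p ⊗ m) ⊗ (n ⊗ r) ⊜ (p ⊗ r) ⊗ (m ⊗ n)) refl
      (seq m k) (seq n k) (seq p k) (seq r k))
    (pointwise λ k → solve 4 (λ m n q s → (q ⊗ n) ⊗ (m ⊗ s) ⊜ (q ⊗ s) ⊗ (m ⊗ n)) refl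
      (seq m k) (seq n k) (seq q k) (seq s k))
    (*-mono-≼ {p * m} {q * n} {n * r} {m * s}
      (*-≽0 {n} {r} (Pos⇒≽0 n>0) r≽0) (*-≽0 {q} {n} q≽0 (Pos⇒≽0 n>0)) (∙⇒* {p} {m} {q} {n} pm≼qn) (∙⇒* {n} {r} {m} {s} nr≼ms))))

LocallySubmodular : ∀ {n} → (Subset n → ℝ) → Set
LocallySubmodular {n} g = ∀ (S : Subset n) (e f : Fin n) → e ≢ f →
  lookup S e ≡ outside → lookup S f ≡ outside →
  g S ∙ g ((S [ e ]≔ inside) [ f ]≔ inside) ≼ g (S [ e ]≔ inside) ∙ g (S [ f ]≔ inside)

LocallySubmodular-∷ : ∀ {n} {g : Subset (suc n) → ℝ} b →
  LocallySubmodular g → LocallySubmodular (λ S → g (b ∷ S))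
LocallySubmodular-∷ b loc S e f e≢f = loc (b ∷ S) (suc e) (suc f) (e≢f ∘ suc-injective)

-- It is h / g that decreases, along a chain from `S ∩ T` up to `T` that adds one element at a time;
-- the pair `S ∩ T`, `T` encodes an inclusion. A step occurs only at elements of `T` outside `S`,
-- which is the last clause. In the application `step` is local submodularity for the pairs that
-- contain the first element.
ratio-antitone : ∀ {n} (g h : Subset n → ℝ) → (∀ S → Pos (g S)) → (∀ S → Pos (h S)) →
  (∀ S f → lookup S f ≡ outside → g S ∙ h (S [ f ]≔ inside) ≼ h S ∙ g (S [ f ]≔ inside)) →
  ∀ S T → g (S ∩ T) ∙ h T ≼ h (S ∩ T) ∙ g T
ratio-antitone g h g>0 h>0 step [] [] = ∙-comm (g []) (h [])
ratio-antitone g h g>0 h>0 step (outside ∷ S) (outside ∷ T) =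
  ratio-antitone (λ S → g (outside ∷ S)) (λ S → h (outside ∷ S)) (λ S → g>0 (outside ∷ S))
    (λ S → h>0 (outside ∷ S)) (λ S f → step (outside ∷ S) (suc f)) S T
ratio-antitone g h g>0 h>0 step (inside ∷ S) (outside ∷ T) =
  ratio-antitone (λ S → g (outside ∷ S)) (λ S → h (outside ∷ S)) (λ S → g>0 (outside ∷ S))
    (λ S → h>0 (outside ∷ S)) (λ S f → step (outside ∷ S) (suc f)) S T
ratio-antitone g h g>0 h>0 step (inside ∷ S) (inside ∷ T) =
  ratio-antitone (λ S → g (inside ∷ S)) (λ S → h (inside ∷ S)) (λ S → g>0 (inside ∷ S))
    (λ S → h>0 (inside ∷ S)) (λ S f → step (inside ∷ S) (suc f)) S T
ratio-antitone g h g>0 h>0 step (outside ∷ S) (inside ∷ T) = ∙-chain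
  (h>0 (outside ∷ T)) (g>0 (outside ∷ T))
  (Pos⇒≽0 (h>0 (outside ∷ (S ∩ T)))) (Pos⇒≽0 (h>0 (inside ∷ T)))
  (ratio-antitone (λ S → g (outside ∷ S)) (λ S → h (outside ∷ S)) (λ S → g>0 (outside ∷ S))
    (λ S → h>0 (outside ∷ S)) (λ S f → step (outside ∷ S) (suc f)) S T)
  (step (outside ∷ T) zero refl)

-- Writing g₀, g₁ for the restrictions of g to the subsets without and with
-- the first element, the ratio g₁ / g₀ is antitone, so that
-- g₀ (S ∩ T) / g₀ T ≤ g₁ (S ∩ T) / g₁ T ≤ g₁ S / g₁ (S ∪ T).
local⇒submodular : ∀ {n} (g : Subset n → ℝ) → (∀ S → Pos (g S)) → LocallySubmodular g →
  ∀ S T → g (S ∩ T) ∙ g (S ∪ T) ≼ g S ∙ g T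
local⇒submodular {zero} g g>0 loc [] [] = ∙-refl (g []) (g [])
local⇒submodular {suc n} g g>0 loc = sub
  where
  g₀ g₁ : Subset n → ℝ
  g₀ S = g (outside ∷ S)
  g₁ S = g (inside ∷ S)
  sub₁ : ∀ S T → g₁ (S ∩ T) ∙ g₁ (S ∪ T) ≼ g₁ S ∙ g₁ T
  sub₁ = local⇒submodular g₁ (λ S → g>0 (inside ∷ S)) (LocallySubmodular-∷ inside loc)
  mixed : ∀ S T → g₀ (S ∩ T) ∙ g₁ (S ∪ T) ≼ g₀ T ∙ g₁ S
  mixed S T = ∙-chain (g>0 (inside ∷ T)) (g>0 (inside ∷ (S ∩ T)))
    (Pos⇒≽0 (g>0 (outside ∷ T))) (Pos⇒≽0 (g>0 (inside ∷ (S ∪ T))))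
    (∙-swap
      (ratio-antitone g₀ g₁ (λ S → g>0 (outside ∷ S)) (λ S → g>0 (inside ∷ S))
        (λ S f → loc (outside ∷ S) zero (suc f) 0≢1+n refl) S T))
    (∙-swap (sub₁ S T))
  sub : ∀ S T → g (S ∩ T) ∙ g (S ∪ T) ≼ g S ∙ g T
  sub (outside ∷ S) (outside ∷ T) =
    local⇒submodular g₀ (λ S → g>0 (outside ∷ S)) (LocallySubmodular-∷ outside loc) S T
  sub (inside  ∷ S) (inside  ∷ T) = sub₁ S T
  sub (inside  ∷ S) (outside ∷ T) =
    ∙-swap (mixed S T)
  sub (outside ∷ S) (inside  ∷ T) =
    subst₂ (λ I U → g₀ I ∙ g₁ U ≼ g₀ S ∙ g₁ T) (∩-comm T S) (∪-comm T S) (mixed T S)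

-- Expansion of Z along its first variable

-- A Horner form of `Z`: recursion on the ground set replaces the list of subsets and the filtered
-- products, so that the facts below become inductions along a subset.
value : ∀ {n} → (Subset n → ℝ) → (Fin n → ℝ) → ℝ
value {zero}  ω y = ω []
value {suc n} ω y =
  value (λ S → ω (outside ∷ S)) (y ∘ suc) + y zero * value (λ S → ω (inside ∷ S)) (y ∘ suc)

+-≽0 : ∀ {x y} → 0ℝ ≼ x → 0ℝ ≼ y → 0ℝ ≼ x + y
+-≽0 {x} {y} x≽0 y≽0 = ≼-trans {0ℝ} {0ℝ + 0ℝ} {x + y}
  (≐⇒≼ {0ℝ} {0ℝ + 0ℝ} (pointwise λ _ → sym (ℚ.+-identityˡ 0ℚ)))
  (+-mono-≼ {0ℝ} {x} {0ℝ} {y} x≽0 y≽0)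

∏-filter-suc : ∀ {n} (y : Fin (suc n) → ℝ) b S es →
  ⟦ ∏ (map var (filter (_∈? (b ∷ S)) (map suc es))) ⟧ y
    ≐ ⟦ ∏ (map var (filter (_∈? S) es)) ⟧ (y ∘ suc)
∏-filter-suc y b S [] .at k = refl
∏-filter-suc y b S (e ∷ es) .at k with does (e ∈? S)
... | true  = cong (seq (y (suc e)) k ℚ.*_) (∏-filter-suc y b S es .at k)
... | false = ∏-filter-suc y b S es .at k

∏-tabulate-suc : ∀ {n} (y : Fin (suc n) → ℝ) b S →
  ⟦ ∏ (map var (filter (_∈? (b ∷ S)) (tabulate suc))) ⟧ y ≐ ⟦ monomial S ⟧ (y ∘ suc)
∏-tabulate-suc y b S = subst
  (λ es → ⟦ ∏ (map var (filter (_∈? (b ∷ S)) es)) ⟧ y ≐ ⟦ monomial S ⟧ (y ∘ suc))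
  (map-tabulate id suc) (∏-filter-suc y b S (allFin _))

term : ∀ {n} → (Subset n → ℝ) → Subset n → Poly n
term ω S = con (ω S) :* monomial S

∑-++ : ∀ {n} (y : Fin n → ℝ) ps qs → ⟦ ∑ (ps ++ qs) ⟧ y ≐ ⟦ ∑ ps ⟧ y + ⟦ ∑ qs ⟧ y
∑-++ y [] qs .at k = sym (ℚ.+-identityˡ (seq (⟦ ∑ qs ⟧ y) k))
∑-++ y (p ∷ ps) qs .at k = trans (cong (seq (⟦ p ⟧ y) k ℚ.+_) (∑-++ y ps qs .at k))
  (sym (ℚ.+-assoc (seq (⟦ p ⟧ y) k) (seq (⟦ ∑ ps ⟧ y) k) (seq (⟦ ∑ qs ⟧ y) k)))

∑-outside : ∀ {n} (ω : Subset (suc n) → ℝ) y Ss →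
  ⟦ ∑ (map (term ω) (map (outside ∷_) Ss)) ⟧ y
    ≐ ⟦ ∑ (map (term (λ S → ω (outside ∷ S))) Ss) ⟧ (y ∘ suc)
∑-outside ω y [] .at k = refl
∑-outside ω y (S ∷ Ss) .at k = cong₂ ℚ._+_
  (cong (seq (ω (outside ∷ S)) k ℚ.*_) (∏-tabulate-suc y outside S .at k))
  (∑-outside ω y Ss .at k)

∑-inside : ∀ {n} (ω : Subset (suc n) → ℝ) y Ss →
  ⟦ ∑ (map (term ω) (map (inside ∷_) Ss)) ⟧ y
    ≐ y zero * ⟦ ∑ (map (term (λ S → ω (inside ∷ S))) Ss) ⟧ (y ∘ suc)
∑-inside ω y [] .at k = sym (ℚ.*-zeroʳ (seq (y zero) k))
∑-inside ω y (S ∷ Ss) .at k = trans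
  (cong₂ (λ s t → seq (ω (inside ∷ S)) k ℚ.* (seq (y zero) k ℚ.* s) ℚ.+ t)
    (∏-tabulate-suc y inside S .at k) (∑-inside ω y Ss .at k))
  (solve 4 (λ a y m s → (a ⊗ (y ⊗ m)) ⊕ (y ⊗ s) ⊜ y ⊗ ((a ⊗ m) ⊕ s)) refl
    (seq (ω (inside ∷ S)) k) (seq (y zero) k) (seq (⟦ monomial S ⟧ (y ∘ suc)) k)
    (seq (⟦ ∑ (map (term (λ S → ω (inside ∷ S))) Ss) ⟧ (y ∘ suc)) k))

Z≐value : ∀ {n} (ω : Subset n → ℝ) y → ⟦ Z ω ⟧ y ≐ value ω y
Z≐value {zero} ω y .at k = trans (ℚ.+-identityʳ (seq (ω []) k ℚ.* 1ℚ)) (ℚ.*-identityʳ (seq (ω []) k))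
Z≐value {suc n} ω y .at k = trans
  (cong (λ ps → seq (⟦ ∑ ps ⟧ y) k)
    (map-++ (term ω) (map (outside ∷_) (subsets n)) (map (inside ∷_) (subsets n))))
  (trans
    (∑-++ y (map (term ω) (map (outside ∷_) (subsets n)))
            (map (term ω) (map (inside ∷_) (subsets n))) .at k)
    (cong₂ ℚ._+_
      (trans (∑-outside ω y (subsets n) .at k)
        (Z≐value (λ S → ω (outside ∷ S)) (y ∘ suc) .at k))
      (trans (∑-inside ω y (subsets n) .at k)
        (cong (seq (y zero) k ℚ.*_) (Z≐value (λ S → ω (inside ∷ S)) (y ∘ suc) .at k)))))

value-≽0 : ∀ {n} (ω : Subset n → ℝ) y → (∀ S → 0ℝ ≼ ω S) → (∀ c → Pos (y c)) →
  0ℝ ≼ value ω y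
value-≽0 {zero}  ω y ω≽0 y>0 = ω≽0 []
value-≽0 {suc n} ω y ω≽0 y>0 = ≼-trans {0ℝ} {V₀ + y zero * V₁} {value ω y}
  (+-≽0 {V₀} {y zero * V₁}
    (value-≽0 (λ S → ω (outside ∷ S)) (y ∘ suc) (λ S → ω≽0 (outside ∷ S)) (λ c → y>0 (suc c)))
    (*-≽0 {y zero} {V₁} (Pos⇒≽0 (y>0 zero))
      (value-≽0 (λ S → ω (inside ∷ S)) (y ∘ suc) (λ S → ω≽0 (inside ∷ S)) (λ c → y>0 (suc c)))))
  -- Both sides unfold to the same sequence; going through `_≐_` compares the sequences alone and
  -- not the Cauchy proofs.
  (≐⇒≼ {V₀ + y zero * V₁} {value ω y} (pointwise λ k → refl))
  where
  V₀ V₁ : ℝ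
  V₀ = value (λ S → ω (outside ∷ S)) (y ∘ suc)
  V₁ = value (λ S → ω (inside ∷ S)) (y ∘ suc)

-- The recursion follows `A`: the branch that contains it is positive, and the other branch is
-- nonnegative.
value-Pos : ∀ {n} (ω : Subset n → ℝ) y → (∀ S → 0ℝ ≼ ω S) → (∀ c → Pos (y c)) →
  ∀ A → Pos (ω A) → Pos (value ω y)
value-Pos {zero} ω y ω≽0 y>0 [] ωA>0 = ωA>0
value-Pos {suc n} ω y ω≽0 y>0 (outside ∷ A) ωA>0 = Pos-resp
  {V₀ + y zero * V₁} {value ω y} (pointwise λ k → refl)
  (+-Pos {V₀} {y zero * V₁}
    (value-Pos (λ S → ω (outside ∷ S)) (y ∘ suc) (λ S → ω≽0 (outside ∷ S)) (λ c → y>0 (suc c))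
      A ωA>0)
    (*-≽0 {y zero} {V₁} (Pos⇒≽0 (y>0 zero))
      (value-≽0 (λ S → ω (inside ∷ S)) (y ∘ suc) (λ S → ω≽0 (inside ∷ S)) (λ c → y>0 (suc c)))))
  where
  V₀ V₁ : ℝ
  V₀ = value (λ S → ω (outside ∷ S)) (y ∘ suc)
  V₁ = value (λ S → ω (inside ∷ S)) (y ∘ suc)
value-Pos {suc n} ω y ω≽0 y>0 (inside ∷ A) ωA>0 = Pos-resp
  {y zero * V₁ + V₀} {value ω y}
  (pointwise λ k → ℚ.+-comm (seq (y zero) k ℚ.* seq V₁ k) (seq V₀ k))
  (+-Pos {y zero * V₁} {V₀}
    (*-Pos {y zero} {V₁} (y>0 zero)
      (value-Pos (λ S → ω (inside ∷ S)) (y ∘ suc) (λ S → ω≽0 (inside ∷ S)) (λ c → y>0 (suc c))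
        A ωA>0))
    (value-≽0 (λ S → ω (outside ∷ S)) (y ∘ suc) (λ S → ω≽0 (outside ∷ S)) (λ c → y>0 (suc c))))
  where
  V₀ V₁ : ℝ
  V₀ = value (λ S → ω (outside ∷ S)) (y ∘ suc)
  V₁ = value (λ S → ω (inside ∷ S)) (y ∘ suc)

-- The weights ε^|A Δ S|

total : ∀ {n} → (Subset n → ℝ) → ℝ
total {zero}  ω = ω []
total {suc n} ω = total (λ S → ω (outside ∷ S)) + total (λ S → ω (inside ∷ S))

total-∷ : ∀ {n} (ω : Subset (suc n) → ℝ) s →
  total (λ S → ω (s ∷ S)) + total (λ S → ω (not s ∷ S)) ≐ total ω
total-∷ ω outside .at k = refl
total-∷ ω inside  .at k = ℚ.+-comm
  (seq (total (λ S → ω (inside ∷ S))) k) (seq (total (λ S → ω (outside ∷ S))) k)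

-- The sum over all A of ε^|A Δ S| ω A.
perturbed : ∀ {n} → ℚ → (Subset n → ℝ) → Subset n → ℝ
perturbed ε ω []      = ω []
perturbed ε ω (s ∷ S) =
  perturbed ε (λ A → ω (s ∷ A)) S + ι ε * perturbed ε (λ A → ω (not s ∷ A)) S

x≼x+y : ∀ x {y} → 0ℝ ≼ y → x ≼ x + y
x≼x+y x {y} y≽0 = ≼-trans {x} {x + 0ℝ} {x + y}
  (≐⇒≼ {x} {x + 0ℝ} (pointwise λ k → sym (ℚ.+-identityʳ (seq x k))))
  (+-mono-≼ {x} {x} {0ℝ} {y} (≼-refl {x}) y≽0)

perturbed-≽0 : ∀ {n ε} → 0ℝ ≼ ι ε → (ω : Subset n → ℝ) → (∀ S → 0ℝ ≼ ω S) →
  ∀ S → 0ℝ ≼ perturbed ε ω S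
perturbed-≽0 ε≽0 ω ω≽0 [] = ω≽0 []
perturbed-≽0 {ε = ε} ε≽0 ω ω≽0 (s ∷ S) = ≼-trans {0ℝ} {P + ι ε * Q} {perturbed ε ω (s ∷ S)}
  (+-≽0 {P} {ι ε * Q}
    (perturbed-≽0 ε≽0 (λ A → ω (s ∷ A)) (λ A → ω≽0 (s ∷ A)) S)
    (*-≽0 {ι ε} {Q} ε≽0
      (perturbed-≽0 ε≽0 (λ A → ω (not s ∷ A)) (λ A → ω≽0 (not s ∷ A)) S)))
  (≐⇒≼ {P + ι ε * Q} {perturbed ε ω (s ∷ S)} (pointwise λ k → refl))
  where
  P Q : ℝ
  P = perturbed ε (λ A → ω (s ∷ A)) S
  Q = perturbed ε (λ A → ω (not s ∷ A)) S

-- Keep only the term A = S, whose weight is ε^0 = 1.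
perturbed-lower : ∀ {n ε} → 0ℝ ≼ ι ε → (ω : Subset n → ℝ) → (∀ S → 0ℝ ≼ ω S) →
  ∀ S → ω S ≼ perturbed ε ω S
perturbed-lower ε≽0 ω ω≽0 [] = ≼-refl {ω []}
perturbed-lower {ε = ε} ε≽0 ω ω≽0 (s ∷ S) =
  ≼-trans {ω (s ∷ S)} {P} {perturbed ε ω (s ∷ S)}
    (perturbed-lower ε≽0 (λ A → ω (s ∷ A)) (λ A → ω≽0 (s ∷ A)) S)
    (≼-trans {P} {P + ι ε * Q} {perturbed ε ω (s ∷ S)}
      (x≼x+y P {ι ε * Q} (*-≽0 {ι ε} {Q} ε≽0
        (perturbed-≽0 ε≽0 (λ A → ω (not s ∷ A)) (λ A → ω≽0 (not s ∷ A)) S)))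
      (≐⇒≼ {P + ι ε * Q} {perturbed ε ω (s ∷ S)} (pointwise λ k → refl)))
  where
  P Q : ℝ
  P = perturbed ε (λ A → ω (s ∷ A)) S
  Q = perturbed ε (λ A → ω (not s ∷ A)) S

perturbed≼total : ∀ {n ε} → 0ℝ ≼ ι ε → ε ℚ.≤ 1ℚ → (ω : Subset n → ℝ) → (∀ S → 0ℝ ≼ ω S) →
  ∀ S → perturbed ε ω S ≼ total ω
perturbed≼total ε≽0 ε≤1 ω ω≽0 [] = ≼-refl {ω []}
perturbed≼total {ε = ε} ε≽0 ε≤1 ω ω≽0 (s ∷ S) =
  ≼-resp {P + ι ε * Q} {perturbed ε ω (s ∷ S)} {M + 1ℝ * N} {total ω}
    (pointwise λ k → refl)
    (pointwise λ k → trans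
      (cong (seq M k ℚ.+_) (ℚ.*-identityˡ (seq N k))) (total-∷ ω s .at k))
    (+-mono-≼ {P} {M} {ι ε * Q} {1ℝ * N}
      (perturbed≼total ε≽0 ε≤1 (λ A → ω (s ∷ A)) (λ A → ω≽0 (s ∷ A)) S)
      (*-mono-≼ {ι ε} {1ℝ} {Q} {N}
        (perturbed-≽0 ε≽0 (λ A → ω (not s ∷ A)) (λ A → ω≽0 (not s ∷ A)) S)
        (Pos⇒≽0 {1ℝ} (above (ℚ.positive⁻¹ 1ℚ) {0} λ _ _ → ℚ.≤-refl))
        -- `1ℝ` and `ι 1ℚ` have the same sequence but different Cauchy proofs. The field `within`
        -- mentions only sequences, so repacking it changes the endpoint.
        (approximately (ι-mono ε≤1 .within))
        (perturbed≼total ε≽0 ε≤1 (λ A → ω (not s ∷ A)) (λ A → ω≽0 (not s ∷ A)) S)))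
  where
  P Q M N : ℝ
  P = perturbed ε (λ A → ω (s ∷ A)) S
  Q = perturbed ε (λ A → ω (not s ∷ A)) S
  M = total (λ A → ω (s ∷ A))
  N = total (λ A → ω (not s ∷ A))

-- Every A other than S has |A Δ S| ≥ 1, hence weight at most ε. In the recursion the sets that
-- disagree with S at the first element already carry a factor ε, and `total` bounds what remains.
perturbed-upper : ∀ {n ε} → 0ℝ ≼ ι ε → ε ℚ.≤ 1ℚ → (ω : Subset n → ℝ) → (∀ S → 0ℝ ≼ ω S) →
  ∀ S → perturbed ε ω S ≼ ω S + ι ε * total ω
perturbed-upper {ε = ε} ε≽0 ε≤1 ω ω≽0 [] =
  ≼-trans {ω []} {ω [] + ι ε * ω []} {ω [] + ι ε * total ω}
    (x≼x+y (ω []) {ι ε * ω []} (*-≽0 {ι ε} {ω []} ε≽0 (ω≽0 [])))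
    (≐⇒≼ {ω [] + ι ε * ω []} {ω [] + ι ε * total ω} (pointwise λ k → refl))
perturbed-upper {ε = ε} ε≽0 ε≤1 ω ω≽0 (s ∷ S) =
  ≼-resp {P + ι ε * Q} {perturbed ε ω (s ∷ S)}
    {(ω (s ∷ S) + ι ε * total (λ A → ω (s ∷ A))) + ι ε * total (λ A → ω (not s ∷ A))} {ω (s ∷ S) + ι ε * total ω}
    (pointwise λ k → refl)
    (pointwise λ k → trans
      (solve 4 (λ w e m n → (w ⊕ (e ⊗ m)) ⊕ (e ⊗ n) ⊜ w ⊕ (e ⊗ (m ⊕ n))) refl
        (seq (ω (s ∷ S)) k) ε (seq M k) (seq N k))
      (cong (λ t → seq (ω (s ∷ S)) k ℚ.+ ε ℚ.* t) (total-∷ ω s .at k)))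
    (+-mono-≼ {P} {ω (s ∷ S) + ι ε * total (λ A → ω (s ∷ A))} {ι ε * Q} {ι ε * total (λ A → ω (not s ∷ A))}
      (perturbed-upper ε≽0 ε≤1 (λ A → ω (s ∷ A)) (λ A → ω≽0 (s ∷ A)) S)
      (*-mono-≼ {ι ε} {ι ε} {Q} {total (λ A → ω (not s ∷ A))}
        (perturbed-≽0 ε≽0 (λ A → ω (not s ∷ A)) (λ A → ω≽0 (not s ∷ A)) S)
        ε≽0 (≼-refl {ι ε})
        (perturbed≼total ε≽0 ε≤1 (λ A → ω (not s ∷ A)) (λ A → ω≽0 (not s ∷ A)) S)))
  where
  P Q M N : ℝ
  P = perturbed ε (λ A → ω (s ∷ A)) S
  Q = perturbed ε (λ A → ω (not s ∷ A)) S
  M = total (λ A → ω (s ∷ A))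
  N = total (λ A → ω (not s ∷ A))

-- Two-valued points and the scaling factors ε^|S|

point : ∀ {n} → ℚ → ℚ → Subset n → Fin n → ℝ
point ε K S c = if lookup S c then ι K else ι ε

weight : ∀ {n} → ℚ → Subset n → ℚ
weight ε []            = 1ℚ
weight ε (outside ∷ S) = weight ε S
weight ε (inside  ∷ S) = ε ℚ.* weight ε S

weight-pos : ∀ {n ε} → 0ℚ ℚ.< ε → (S : Subset n) → 0ℚ ℚ.< weight ε S
weight-pos 0<ε []            = ℚ.positive⁻¹ 1ℚ
weight-pos 0<ε (outside ∷ S) = weight-pos 0<ε S
weight-pos 0<ε (inside  ∷ S) = pos*pos 0<ε (weight-pos 0<ε S)

weight-modular : ∀ {n} ε (S T : Subset n) →
  weight ε (S ∩ T) ℚ.* weight ε (S ∪ T) ≡ weight ε S ℚ.* weight ε T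
weight-modular ε [] [] = refl
weight-modular ε (outside ∷ S) (outside ∷ T) = weight-modular ε S T
weight-modular ε (outside ∷ S) (inside ∷ T) = trans
  (solve 3 (λ e i u → i ⊗ (e ⊗ u) ⊜ e ⊗ (i ⊗ u)) refl ε (weight ε (S ∩ T)) (weight ε (S ∪ T)))
  (trans (cong (ε ℚ.*_) (weight-modular ε S T))
    (solve 3 (λ e s t → e ⊗ (s ⊗ t) ⊜ s ⊗ (e ⊗ t)) refl ε (weight ε S) (weight ε T)))
weight-modular ε (inside ∷ S) (outside ∷ T) = trans
  (solve 3 (λ e i u → i ⊗ (e ⊗ u) ⊜ e ⊗ (i ⊗ u)) refl ε (weight ε (S ∩ T)) (weight ε (S ∪ T)))
  (trans (cong (ε ℚ.*_) (weight-modular ε S T))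
    (sym (ℚ.*-assoc ε (weight ε S) (weight ε T))))
weight-modular ε (inside ∷ S) (inside ∷ T) = trans
  (solve 3 (λ e i u → (e ⊗ i) ⊗ (e ⊗ u) ⊜ (e ⊗ e) ⊗ (i ⊗ u)) refl
    ε (weight ε (S ∩ T)) (weight ε (S ∪ T)))
  (trans (cong (ε ℚ.* ε ℚ.*_) (weight-modular ε S T))
    (solve 3 (λ e s t → (e ⊗ e) ⊗ (s ⊗ t) ⊜ (e ⊗ s) ⊗ (e ⊗ t)) refl ε (weight ε S) (weight ε T)))

-- At `point ε K S` the monomial of A is K^|A ∩ S| ε^|A ∖ S|. As K = 1 / ε, multiplying by ε^|S|
-- gives the exponent |S| - |A ∩ S| + |A ∖ S| = |A Δ S|.
perturbed≐value : ∀ {n ε K} → ε ℚ.* K ≡ 1ℚ → (ω : Subset n → ℝ) → ∀ S →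
  perturbed ε ω S ≐ ι (weight ε S) * value ω (point ε K S)
perturbed≐value εK≡1 ω [] .at k = sym (ℚ.*-identityˡ (seq (ω []) k))
perturbed≐value {ε = ε} {K} εK≡1 ω (outside ∷ S) .at k = trans
  (cong₂ (λ s t → s ℚ.+ ε ℚ.* t)
    (perturbed≐value {K = K} εK≡1 (λ A → ω (outside ∷ A)) S .at k)
    (perturbed≐value {K = K} εK≡1 (λ A → ω (inside ∷ A)) S .at k))
  (solve 4 (λ e w v v′ → (w ⊗ v) ⊕ (e ⊗ (w ⊗ v′)) ⊜ w ⊗ (v ⊕ (e ⊗ v′))) refl
    ε (weight ε S) (seq (value (λ A → ω (outside ∷ A)) (point ε K S)) k)
    (seq (value (λ A → ω (inside ∷ A)) (point ε K S)) k))
perturbed≐value {ε = ε} {K} εK≡1 ω (inside ∷ S) .at k = trans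
  (cong₂ (λ s t → s ℚ.+ ε ℚ.* t)
    (perturbed≐value {K = K} εK≡1 (λ A → ω (inside ∷ A)) S .at k)
    (perturbed≐value {K = K} εK≡1 (λ A → ω (outside ∷ A)) S .at k))
  (trans
    -- The term that agrees with `S` has no factor ε, so 1 = ε K is inserted to extract the ε of the
    -- weight and the K of the point.
    (cong (ℚ._+ ε ℚ.* (w ℚ.* v)) (trans (sym (ℚ.*-identityˡ (w ℚ.* v′)))
      (cong (ℚ._* (w ℚ.* v′)) (sym εK≡1))))
    (solve 5 (λ e κ′ w v v′ →
      ((e ⊗ κ′) ⊗ (w ⊗ v′)) ⊕ (e ⊗ (w ⊗ v)) ⊜ (e ⊗ w) ⊗ (v ⊕ (κ′ ⊗ v′))) refl ε K w v v′))
  where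
  w v v′ : ℚ
  w  = weight ε S
  v  = seq (value (λ A → ω (outside ∷ A)) (point ε K S)) k
  v′ = seq (value (λ A → ω (inside ∷ A)) (point ε K S)) k

-- The Rayleigh inequality at two-valued points

point-Pos : ∀ {n ε K} → 0ℚ ℚ.< ε → 0ℚ ℚ.< K → ∀ (S : Subset n) c → Pos (point ε K S c)
point-Pos 0<ε 0<K S c with lookup S c
... | true  = ι-Pos 0<K
... | false = ι-Pos 0<ε

point-step : ∀ {n ε K} (S T : Subset n) c → lookup T c ≡ inside → lookup S c ≡ outside →
  point ε K T c + (- point ε K S c) ≐ ι (K ℚ.- ε)
point-step {ε = ε} {K} S T c T∋c S∌c .at k = cong₂
  (λ b b′ → seq (if b then ι K else ι ε) k ℚ.- seq (if b′ then ι K else ι ε) k) T∋c S∌c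

point-agree : ∀ {n ε K} (S : Subset n) e →
  AgreeOff e (point ε K S) (point ε K (S [ e ]≔ inside))
point-agree {ε = ε} {K} S e c c≢e =
  cong (λ b → if b then ι K else ι ε) (lookup∘update′ c≢e S inside)

∙-gap : ∀ {a b c d t Δ} → 0ℝ ≼ t → 0ℝ ≼ Δ → a * b + (t * t) * Δ ≐ c * d → a ∙ b ≼ c ∙ d
∙-gap {a} {b} {c} {d} {t} {Δ} t≽0 Δ≽0 eq = *⇒∙ {a} {b} {c} {d}
  (≼-trans {a * b} {a * b + (t * t) * Δ} {c * d}
    (x≼x+y (a * b) {(t * t) * Δ} (*-≽0 {t * t} {Δ} (*-≽0 {t} {t} t≽0 t≽0) Δ≽0))
    (≐⇒≼ {a * b + (t * t) * Δ} {c * d} eq))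

Rayleigh⇒local : ∀ {n ε K} (ω : Subset n → ℝ) → Rayleigh ω →
  0ℚ ℚ.< ε → 0ℚ ℚ.< K → ε ℚ.≤ K →
  LocallySubmodular (λ S → ⟦ Z ω ⟧ (point ε K S))
Rayleigh⇒local {ε = ε} {K} ω ray 0<ε 0<K ε≤K S e f e≢f S∌e S∌f = ∙-gap
  {⟦ Z ω ⟧ (point ε K S)} {⟦ Z ω ⟧ (point ε K ((S [ e ]≔ inside) [ f ]≔ inside))}
  {⟦ Z ω ⟧ (point ε K (S [ e ]≔ inside))} {⟦ Z ω ⟧ (point ε K (S [ f ]≔ inside))}
  {ι (K ℚ.- ε)} {⟦ ΔZ ω e f ⟧ (point ε K S)}
  (approximately (ι-mono
    (subst (ℚ._≤ K ℚ.- ε) (ℚ.+-inverseʳ ε) (ℚ.+-monoˡ-≤ (ℚ.- ε) ε≤K)) .within))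
  (≤⇒≼ {0ℝ} {⟦ ΔZ ω e f ⟧ (point ε K S)}
    (ray e f e≢f (point ε K S) (λ c → Pos⇒< {point ε K S c} (point-Pos 0<ε 0<K S c))))
  (pointwise λ k → second-difference ω {e} {f}
    {point ε K S} {point ε K (S [ e ]≔ inside)} {point ε K (S [ f ]≔ inside)}
    {point ε K ((S [ e ]≔ inside) [ f ]≔ inside)} (ι (K ℚ.- ε))
    (point-agree S e) (point-agree S f) (point-agree (S [ e ]≔ inside) f)
    (point-step S (S [ e ]≔ inside) e (lookup∘update e S inside) S∌e)
    (point-step S (S [ f ]≔ inside) f (lookup∘update f S inside) S∌f)
    (point-step (S [ e ]≔ inside) ((S [ e ]≔ inside) [ f ]≔ inside) f
      (lookup∘update f (S [ e ]≔ inside) inside)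
      (trans (lookup∘update′ (e≢f ∘ sym) S inside) S∌f)) .at k)

∙-scale : ∀ {a b c d a′ b′ c′ d′ w} → 0ℝ ≼ w →
  a′ * b′ ≐ (a * b) * w → c′ * d′ ≐ (c * d) * w → a ∙ b ≼ c ∙ d → a′ * b′ ≼ c′ * d′
∙-scale {a} {b} {c} {d} {a′} {b′} {c′} {d′} {w} w≽0 eq eq′ h =
  ≼-resp {(a * b) * w} {a′ * b′} {(c * d) * w} {c′ * d′}
    (≐-sym {a′ * b′} {(a * b) * w} eq) (≐-sym {c′ * d′} {(c * d) * w} eq′)
    (*-monoʳ-≼ {w} w≽0 {a * b} {c * d} (∙⇒* {a} {b} {c} {d} h))

perturbed-submodular : ∀ {n ε K} (ω : Subset n → ℝ) → Rayleigh ω → (∀ S → 0ℝ ≼ ω S) →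
  ∀ A → Pos (ω A) → 0ℚ ℚ.< ε → ε ℚ.≤ 1ℚ →
  0ℚ ℚ.< K → ε ℚ.* K ≡ 1ℚ →
  ∀ S T → perturbed ε ω (S ∩ T) * perturbed ε ω (S ∪ T) ≼ perturbed ε ω S * perturbed ε ω T
perturbed-submodular {ε = ε} {K} ω ray ω≽0 A ωA>0 0<ε ε≤1 0<K εK≡1 S T =
  ∙-scale {g (S ∩ T)} {g (S ∪ T)} {g S} {g T}
    {perturbed ε ω (S ∩ T)} {perturbed ε ω (S ∪ T)} {perturbed ε ω S} {perturbed ε ω T} {ι w}
    (Pos⇒≽0 {ι w} (ι-Pos (pos*pos (weight-pos 0<ε (S ∩ T)) (weight-pos 0<ε (S ∪ T)))))
    (pointwise (regroup (S ∩ T) (S ∪ T) refl))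
    (pointwise (regroup S T (weight-modular ε S T)))
    (local⇒submodular g g>0 (Rayleigh⇒local ω ray 0<ε 0<K ε≤K) S T)
  where
  ε≤K : ε ℚ.≤ K
  -- As ε ≤ 1, its reciprocal K is at least 1.
  ε≤K = ℚ.≤-trans ε≤1 (ℚ.*-cancelˡ-≤-pos ε {{ℚ.positive 0<ε}}
    (subst₂ ℚ._≤_ (sym (ℚ.*-identityʳ ε)) (sym εK≡1) ε≤1))
  g : Subset _ → ℝ
  g S = ⟦ Z ω ⟧ (point ε K S)
  w : ℚ
  w = weight ε (S ∩ T) ℚ.* weight ε (S ∪ T)
  g>0 : ∀ S → Pos (g S)
  g>0 S = Pos-resp {value ω (point ε K S)} {g S} (≐-sym (Z≐value ω (point ε K S)))
    (value-Pos ω (point ε K S) ω≽0 (point-Pos 0<ε 0<K S) A ωA>0)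
  perturbed≡wg : ∀ S k → seq (perturbed ε ω S) k ≡ weight ε S ℚ.* seq (g S) k
  perturbed≡wg S k = trans (perturbed≐value εK≡1 ω S .at k)
    (cong (weight ε S ℚ.*_) (sym (Z≐value ω (point ε K S) .at k)))
  regroup : ∀ U V → w ≡ weight ε U ℚ.* weight ε V → ∀ k →
    seq (perturbed ε ω U) k ℚ.* seq (perturbed ε ω V) k ≡ (seq (g U) k ℚ.* seq (g V) k) ℚ.* w
  regroup U V w≡ k = trans (cong₂ ℚ._*_ (perturbed≡wg U k) (perturbed≡wg V k))
    (trans
      (solve 4 (λ u v a b → (u ⊗ a) ⊗ (v ⊗ b) ⊜ (a ⊗ b) ⊗ (u ⊗ v)) refl
        (weight ε U) (weight ε V) (seq (g U) k) (seq (g V) k))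
      (cong ((seq (g U) k ℚ.* seq (g V) k) ℚ.*_) (sym w≡)))

-- The limit as ε tends to 0

*-perturb : ∀ {a b p q m ε} → 0ℝ ≼ a → 0ℝ ≼ q → 0ℝ ≼ m → 0ℝ ≼ ε →
  p ≼ a + ε * m → q ≼ b + ε * m → q ≼ m →
  p * q ≼ a * b + ε * (a * m + m * m)
*-perturb {a} {b} {p} {q} {m} {ε} a≽0 q≽0 m≽0 ε≽0 p≼ q≼ q≼m =
  ≼-trans {p * q} {(a + ε * m) * q} {a * b + ε * (a * m + m * m)}
    (*-monoʳ-≼ {q} q≽0 {p} {a + ε * m} p≼)
    (≼-resp {a * q + (ε * m) * q} {(a + ε * m) * q}
      {a * (b + ε * m) + (ε * m) * m} {a * b + ε * (a * m + m * m)}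
      (pointwise λ k → sym (ℚ.*-distribʳ-+ (seq q k) (seq a k) (seq ε k ℚ.* seq m k)))
      (pointwise λ k → solve 4 (λ a b m e →
        (a ⊗ (b ⊕ (e ⊗ m))) ⊕ ((e ⊗ m) ⊗ m) ⊜ (a ⊗ b) ⊕ (e ⊗ ((a ⊗ m) ⊕ (m ⊗ m)))) refl
        (seq a k) (seq b k) (seq m k) (seq ε k))
      -- The sharp bound on q is used only beside a; beside ε m the crude bound m is enough. The
      -- error is then ε times a constant independent of ε, the form that `≼-limit` expects.
      (+-mono-≼ {a * q} {a * (b + ε * m)} {(ε * m) * q} {(ε * m) * m}
        (*-mono-≼ {a} {a} {q} {b + ε * m} q≽0 a≽0 (≼-refl {a}) q≼)
        (*-mono-≼ {ε * m} {ε * m} {q} {m} q≽0 (*-≽0 {ε} {m} ε≽0 m≽0) (≼-refl {ε * m}) q≼m)))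

submodular : ∀ {n} (ω : Subset n → ℝ) → Rayleigh ω → (∀ S → 0ℝ ≼ ω S) →
  ∀ A → Pos (ω A) → ∀ S T → ω (S ∩ T) * ω (S ∪ T) ≼ ω S * ω T
submodular ω ray ω≽0 A ωA>0 S T =
  ≼-limit {ω (S ∩ T) * ω (S ∪ T)} {ω S * ω T} (ω S * total ω + total ω * total ω) estimate
  where
  estimate : ∀ {ε} → 0ℚ ℚ.< ε → ε ℚ.≤ 1ℚ →
    ω (S ∩ T) * ω (S ∪ T) ≼ ω S * ω T + ι ε * (ω S * total ω + total ω * total ω)
  estimate {ε} 0<ε ε≤1 =
    let _ , 0<K , εK≡1 = divide 0<ε (ℚ.positive⁻¹ 1ℚ) in
    ≼-trans {ω (S ∩ T) * ω (S ∪ T)} {perturbed ε ω (S ∩ T) * perturbed ε ω (S ∪ T)}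
      {ω S * ω T + ι ε * (ω S * total ω + total ω * total ω)}
      (*-mono-≼ {ω (S ∩ T)} {perturbed ε ω (S ∩ T)} {ω (S ∪ T)} {perturbed ε ω (S ∪ T)}
        (ω≽0 (S ∪ T)) (perturbed-≽0 ε≽0 ω ω≽0 (S ∩ T))
        (perturbed-lower ε≽0 ω ω≽0 (S ∩ T)) (perturbed-lower ε≽0 ω ω≽0 (S ∪ T)))
      (≼-trans {perturbed ε ω (S ∩ T) * perturbed ε ω (S ∪ T)}
        {perturbed ε ω S * perturbed ε ω T}
        {ω S * ω T + ι ε * (ω S * total ω + total ω * total ω)}
        (perturbed-submodular ω ray ω≽0 A ωA>0 0<ε ε≤1 0<K εK≡1 S T)
        (*-perturb {ω S} {ω T} {perturbed ε ω S} {perturbed ε ω T} {total ω} {ι ε}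
          (ω≽0 S) (perturbed-≽0 ε≽0 ω ω≽0 T)
          (≼-trans {0ℝ} {perturbed ε ω T} {total ω}
            (perturbed-≽0 ε≽0 ω ω≽0 T) (perturbed≼total ε≽0 ε≤1 ω ω≽0 T))
          ε≽0
          (perturbed-upper ε≽0 ε≤1 ω ω≽0 S) (perturbed-upper ε≽0 ε≤1 ω ω≽0 T)
          (perturbed≼total ε≽0 ε≤1 ω ω≽0 T)))
    where
    ε≽0 : 0ℝ ≼ ι ε
    ε≽0 = Pos⇒≽0 {ι ε} (ι-Pos 0<ε)

theorem4p4 : (n : ℕ) (ω : Subset n → ℝ) →
    (∀ S → 0ℝ ≤ ω S) →
    ¬ (∀ S → ω S ≈ 0ℝ) →
    Rayleigh ω →
    LogSubmodular ω
-- Constructively `ω≉0` does not yield a set of positive weight. But the goal is a negation, so a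
-- violation `gap` may be assumed: any `A` with 0 < ω A would contradict it, hence every ω A is
-- zero, against `ω≉0`.
theorem4p4 n ω ω≥0 ω≉0 ray S T gap = ω≉0 λ A → ≼-antisym {ω A} {0ℝ}
  (≤⇒≼ {ω A} {0ℝ} λ 0<ωA →
    ≼⇒≤ {ω (S ∩ T) * ω (S ∪ T)} {ω S * ω T}
      (submodular ω ray ω≽0 A (<⇒Pos {ω A} 0<ωA) S T) gap)
  (ω≽0 A)
  where
  ω≽0 : ∀ S → 0ℝ ≼ ω S
  ω≽0 S = ≤⇒≼ {0ℝ} {ω S} (ω≥0 S)
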